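{- Let $n\ge2$. For every decreasing Shellsort gap sequence $H=(h_1>\cdots>h_p=1)$ and every $1\le s<p$, $$W_n(H)\ \ge\ \frac{n^2}{8\pi\bigl(h_{s+1}+\pi n\,\beta_s(H;n)\bigr)}.$$ Consequently (taking the maximum over $s$), $$W_n(H)\ \ge\ \max_{1\le s<p}\frac{n^2}{8\pi\bigl(h_{s+1}+\pi n\,\beta_s(H;n)\bigr)}.$$
   Context: Shellsort: a gap sequence is a decreasing sequence of positive integers $H=(h_1>h_2>\cdots>h_p=1)$. On an array of $n$ distinct keys (a permutation), pass $j$ runs ordinary insertion sort separately on each $h_j$-chain, i.e. on each set of positions with the same remainder modulo $h_j$: each key is repeatedly exchanged with the key $h_j$ positions before it while the two are out of order. Passes are run for $j=1,2,\dots,p$. $W_n(H)$ is the worst-case (over all inputs of $n$ keys) total number of exchanges. $\lVert x\rVert_{\mathbb T}$ denotes the distance from the real number $x$ to the nearest integer. For $1\le s\le p$ and $1\le k<n$, $\delta_s(k)=\max_{1\le j\le s}\lVert kh_j/n\rVert_{\mathbb T}$ and $\beta_s(H;n)=\min_{1\le k<n}\delta_s(k)$. -}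

module Defs where

open import Data.Bool.Base using (if_then_else_)
open import Data.Fin.Base as Fin using (Fin; toℕ; fromℕ<)
import Data.Fin.Properties as Fin
open import Data.Fin.Permutation.Components using (transpose)
import Data.Integer.Base as ℤ
import Data.Integer.Properties as ℤ
import Data.List.Extrema
import Data.List.Extrema.Nat as Nat
open import Data.List.Base as List using (List; []; _∷_)
import Data.List.Relation.Unary.All as All
import Data.List.Relation.Unary.All.Properties as All
open import Data.Nat.Base as ℕ using (ℕ; zero; suc; z≤n; s≤s; NonZero)
open import Data.Nat.DivMod using (m≡m%n+[m/n]*n)
import Data.Nat.Properties as ℕ
open import Data.Product.Base using (∃-syntax; _×_; _,_; proj₁; proj₂; map₂)
open import Data.Rational.Base as ℚ using (ℚ; 0ℚ; 1ℚ; ½; ∣_∣)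
import Data.Rational.Properties as ℚ
open import Data.Rational.Solver using (module +-*-Solver)
import Data.Rational.Unnormalised.Base as ℚᵘ
import Data.Rational.Unnormalised.Properties as ℚᵘ
open import Data.Sum.Base using (inj₁; inj₂)
open import Data.Vec.Base as Vec using (Vec; []; _∷_)
open import Data.Vec.Functional using (Vector)
open import Data.Vec.Relation.Unary.AllPairs using (allPairs?)
open import Data.Vec.Relation.Unary.Unique.Propositional using (Unique)
open import Function.Base using (_∘_)
open import Relation.Binary.Bundles using (DecTotalOrder)
open import Relation.Binary.PropositionalEquality
  using (_≡_; refl; sym; trans; cong; cong₂; subst; subst₂)
open import Relation.Nullary.Decidable using (does; ¬?)
open import Relation.Unary using (Decidable)

open +-*-Solver using (_:+_; _:*_; _:-_; :-_; _:=_; con) renaming (solve to solveℚ)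

------------------------------------------------------------------------
-- Shellsort

record GapSequence (p : ℕ) : Set where
  field
    gap        : Fin p → ℕ
    positive   : ∀ j → NonZero (gap j)
    decreasing : ∀ {i j} → i Fin.< j → gap j ℕ.< gap i
    ends-in-1  : ∃[ j ] suc (toℕ j) ≡ p × gap j ≡ 1

-- The keys of an array of length n are taken from Fin n, so an array with
-- distinct keys is a permutation.
Array : ℕ → Set
Array n = Vector (Fin n) n

State : ℕ → Set
State n = Array n × ℕ

exchange : ∀ {n} → Fin n → Fin n → Array n → Array n
exchange i j a = a ∘ transpose i j

earlier : ∀ {n} h r q → r ℕ.+ suc q ℕ.* h ℕ.< n → r ℕ.+ q ℕ.* h ℕ.< n
earlier h r q = ℕ.≤-<-trans (ℕ.+-monoʳ-≤ r (ℕ.m≤n+m (q ℕ.* h) h))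

-- Move the key at position r + q * h down its chain, counting exchanges.
sink : ∀ {n} (h r q : ℕ) → .(r ℕ.+ q ℕ.* h ℕ.< n) → Array n → Array n × ℕ
sink         h r zero    _     a = a , 0
sink {n = n} h r (suc q) bound a =
  if does (a here Fin.<? a before)
    then map₂ suc (sink h r q (earlier h r q bound) (exchange before here a))
    else (a , 0)
  where
  here before : Fin n
  here   = fromℕ< bound
  before = fromℕ< (earlier h r q bound)

insertKey : ∀ {n} (h : ℕ) .{{_ : NonZero h}} → State n → Fin n → State n
insertKey {n} h (a , c) i =
  map₂ (c ℕ.+_) (sink h (toℕ i ℕ.% h) (toℕ i ℕ./ h) bound a)
  where
  .bound : toℕ i ℕ.% h ℕ.+ toℕ i ℕ./ h ℕ.* h ℕ.< n
  bound = subst (ℕ._< n) (m≡m%n+[m/n]*n (toℕ i) h) (Fin.toℕ<n i)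

chain : ∀ n (h : ℕ) .{{_ : NonZero h}} → ℕ → List (Fin n)
chain n h r = List.filter (λ i → toℕ i ℕ.% h ℕ.≟ r) (List.allFin n)

sortChain : ∀ {n} (h : ℕ) .{{_ : NonZero h}} → State n → ℕ → State n
sortChain {n} h st r = List.foldl (insertKey h) st (chain n h r)

pass : ∀ {n} (h : ℕ) .{{_ : NonZero h}} → State n → State n
pass h st = List.foldl (sortChain h) st (List.upTo h)

shellsort : ∀ {n p} → GapSequence p → Array n → State n
shellsort {p = p} H a =
  List.foldl (λ st j → pass (gap j) {{positive j}} st) (a , 0) (List.allFin p)
  where open GapSequence H

exchanges : ∀ {n p} → GapSequence p → Array n → ℕ
exchanges H = proj₂ ∘ shellsort H

vectors : ∀ {A : Set} n → List A → List (Vec A n)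
vectors zero    xs = [] ∷ []
vectors (suc n) xs = List.cartesianProductWith _∷_ xs (vectors n xs)

unique? : ∀ {m n} → Decidable (Unique {A = Fin m} {n = n})
unique? = allPairs? (λ i j → ¬? (i Fin.≟ j))

inputs : ∀ n → List (Array n)
inputs n = List.map Vec.lookup (List.filter unique? (vectors n (List.allFin n)))

W : ∀ {p} → ℕ → GapSequence p → ℕ
W n H = Nat.max 0 (List.map (exchanges H) (inputs n))

------------------------------------------------------------------------
-- Distance to the nearest integer, δ and β

open Data.List.Extrema (DecTotalOrder.totalOrder ℚ.≤-decTotalOrder)
  using (max; min; ⊥≤max; v≤min⁺)

‖_‖ : ℚ → ℚ
‖ x ‖ = ∣ x ℚ.- ℚ.round x ℚ./ 1 ∣

-- δ and β, like the bound below, are indexed by s as an element of Fin p: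
-- the gaps h₁, …, h_s are those with index below s, and h_{s+1} is gap s.
-- The norms are non-negative, so starting the maximum at 0 is harmless.
δ : ∀ {p} → GapSequence p → (n : ℕ) .{{_ : NonZero n}} → Fin p → ℕ → ℚ
δ {p} H n s k = max 0ℚ
  (List.map (λ j → ‖ ℤ.+ (k ℕ.* gap j) ℚ./ n ‖)
            (List.filter (Fin._<? s) (List.allFin p)))
  where open GapSequence H

-- The minimum over 1 ≤ k < n; for n ≥ 2 its starting value is the term k = 1.
β : ∀ {p} → GapSequence p → (n : ℕ) .{{_ : NonZero n}} → Fin p → ℚ
β H n s = min (δ H n s 1) (List.map (δ H n s ∘ suc) (List.upTo (n ℕ.∸ 1)))

------------------------------------------------------------------------
-- Real numbers as Cauchy sequences of rationals

record ℝ : Set where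
  field
    seq    : ℕ → ℚ
    cauchy : ∀ ε → 0ℚ ℚ.< ε →
             ∃[ N ] ∀ m n → N ℕ.≤ m → N ℕ.≤ n → ∣ seq m ℚ.- seq n ∣ ℚ.≤ ε

open ℝ

infix 4 _≤ᴿ_

_≤ᴿ_ : ℝ → ℝ → Set
x ≤ᴿ y = ∀ ε → 0ℚ ℚ.< ε → ∃[ N ] ∀ n → N ℕ.≤ n → seq x n ℚ.≤ seq y n ℚ.+ ε

Positiveᴿ : ℝ → Set
Positiveᴿ x = ∃[ c ] 0ℚ ℚ.< c × (∃[ N ] ∀ n → N ℕ.≤ n → c ℚ.≤ seq x n)

NonNegativeᴿ : ℝ → Set
NonNegativeᴿ x = ∃[ N ] ∀ n → N ℕ.≤ n → 0ℚ ℚ.≤ seq x n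

½*-pos : ∀ {ε} → 0ℚ ℚ.< ε → 0ℚ ℚ.< ½ ℚ.* ε
½*-pos = ℚ.*-monoʳ-<-pos ½

half+half : ∀ ε → ½ ℚ.* ε ℚ.+ ½ ℚ.* ε ≡ ε
half+half ε = trans (sym (ℚ.*-distribʳ-+ ε ½ ½)) (ℚ.*-identityˡ ε)

*-pos : ∀ {p q} → 0ℚ ℚ.< p → 0ℚ ℚ.< q → 0ℚ ℚ.< p ℚ.* q
*-pos {p} {q} 0<p 0<q = subst (ℚ._< p ℚ.* q) (ℚ.*-zeroʳ p)
  (ℚ.*-monoʳ-<-pos p {{ℚ.positive 0<p}} 0<q)

*-nonNeg : ∀ {p q} → 0ℚ ℚ.≤ p → 0ℚ ℚ.≤ q → 0ℚ ℚ.≤ p ℚ.* q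
*-nonNeg {p} {q} 0≤p 0≤q = subst (ℚ._≤ p ℚ.* q) (ℚ.*-zeroʳ p)
  (ℚ.*-monoˡ-≤-nonNeg p {{ℚ.nonNegative 0≤p}} 0≤q)

*-mono : ∀ {p q r s} → 0ℚ ℚ.≤ r → 0ℚ ℚ.≤ q → p ℚ.≤ q → r ℚ.≤ s →
         p ℚ.* r ℚ.≤ q ℚ.* s
*-mono {p} {q} {r} {s} 0≤r 0≤q p≤q r≤s = ℚ.≤-trans
  (ℚ.*-monoʳ-≤-nonNeg r {{ℚ.nonNegative 0≤r}} p≤q)
  (ℚ.*-monoˡ-≤-nonNeg q {{ℚ.nonNegative 0≤q}} r≤s)

p≤∣p∣ : ∀ p → p ℚ.≤ ∣ p ∣
p≤∣p∣ p with ℚ.≤-total 0ℚ p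
... | inj₁ 0≤p = ℚ.≤-reflexive (sym (ℚ.0≤p⇒∣p∣≡p 0≤p))
... | inj₂ p≤0 = ℚ.≤-trans p≤0 (ℚ.0≤∣p∣ p)

∣p-q∣≡∣q-p∣ : ∀ p q → ∣ p ℚ.- q ∣ ≡ ∣ q ℚ.- p ∣
∣p-q∣≡∣q-p∣ p q = trans (sym (ℚ.∣-p∣≡∣p∣ (p ℚ.- q)))
  (cong ∣_∣ (solveℚ 2 (λ p q → :- (p :- q) := q :- p) refl p q))

∣p-q∣≤⇒p≤q+ : ∀ p q {ε} → ∣ p ℚ.- q ∣ ℚ.≤ ε → p ℚ.≤ q ℚ.+ ε
∣p-q∣≤⇒p≤q+ p q {ε} h = subst (ℚ._≤ q ℚ.+ ε)
  (solveℚ 2 (λ p q → q :+ (p :- q) := p) refl p q)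
  (ℚ.+-monoʳ-≤ q (ℚ.≤-trans (p≤∣p∣ (p ℚ.- q)) h))

p≤q+⇒p-q≤ : ∀ p q {ε} → p ℚ.≤ q ℚ.+ ε → p ℚ.- q ℚ.≤ ε
p≤q+⇒p-q≤ p q {ε} h = subst (p ℚ.- q ℚ.≤_)
  (solveℚ 2 (λ q ε → q :+ ε :- q := ε) refl q ε)
  (ℚ.+-monoˡ-≤ (ℚ.- q) h)

∣p-q∣≤ : ∀ p q {ε} → p ℚ.≤ q ℚ.+ ε → q ℚ.≤ p ℚ.+ ε → ∣ p ℚ.- q ∣ ℚ.≤ ε
∣p-q∣≤ p q {ε} h k with ℚ.∣p∣≡p∨∣p∣≡-p (p ℚ.- q)
... | inj₁ eq = subst (ℚ._≤ ε) (sym eq) (p≤q+⇒p-q≤ p q h)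
... | inj₂ eq = subst (ℚ._≤ ε)
  (sym (trans eq (solveℚ 2 (λ p q → :- (p :- q) := q :- p) refl p q)))
  (p≤q+⇒p-q≤ q p k)

p≤p+ε : ∀ {p ε} → 0ℚ ℚ.≤ ε → p ℚ.≤ p ℚ.+ ε
p≤p+ε {p} {ε} 0≤ε = subst (ℚ._≤ p ℚ.+ ε) (ℚ.+-identityʳ p) (ℚ.+-monoʳ-≤ p 0≤ε)

⊔-close : ∀ p q p′ q′ {ε} → ∣ p ℚ.- p′ ∣ ℚ.≤ ε → ∣ q ℚ.- q′ ∣ ℚ.≤ ε →
          ∣ (p ℚ.⊔ q) ℚ.- (p′ ℚ.⊔ q′) ∣ ℚ.≤ ε
⊔-close p q p′ q′ {ε} h k = ∣p-q∣≤ (p ℚ.⊔ q) (p′ ℚ.⊔ q′)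
  (below p q p′ q′ (∣p-q∣≤⇒p≤q+ p p′ h) (∣p-q∣≤⇒p≤q+ q q′ k))
  (below p′ q′ p q (∣p-q∣≤⇒p≤q+ p′ p (subst (ℚ._≤ ε) (∣p-q∣≡∣q-p∣ p p′) h))
                   (∣p-q∣≤⇒p≤q+ q′ q (subst (ℚ._≤ ε) (∣p-q∣≡∣q-p∣ q q′) k)))
  where
  below : ∀ p q p′ q′ → p ℚ.≤ p′ ℚ.+ ε → q ℚ.≤ q′ ℚ.+ ε →
          p ℚ.⊔ q ℚ.≤ (p′ ℚ.⊔ q′) ℚ.+ ε
  below p q p′ q′ h k = ℚ.⊔-lub
    (ℚ.≤-trans h (ℚ.+-monoˡ-≤ ε (ℚ.p≤p⊔q p′ q′)))
    (ℚ.≤-trans k (ℚ.+-monoˡ-≤ ε (ℚ.p≤q⊔p p′ q′)))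

-- Joint stage beyond which two eventual properties hold.
⊔ˡ : ∀ {M N n} → M ℕ.⊔ N ℕ.≤ n → M ℕ.≤ n
⊔ˡ {M} {N} = ℕ.≤-trans (ℕ.m≤m⊔n M N)

⊔ʳ : ∀ {M N n} → M ℕ.⊔ N ℕ.≤ n → N ℕ.≤ n
⊔ʳ {M} {N} = ℕ.≤-trans (ℕ.m≤n⊔m M N)

bounded : (x : ℝ) → ∃[ B ] 0ℚ ℚ.< B × (∃[ N ] ∀ n → N ℕ.≤ n → ∣ seq x n ∣ ℚ.≤ B)
bounded x with cauchy x 1ℚ (ℚ.positive⁻¹ 1ℚ)
... | N , close = ∣ seq x N ∣ ℚ.+ 1ℚ
                , ℚ.+-mono-≤-< (ℚ.0≤∣p∣ (seq x N)) (ℚ.positive⁻¹ 1ℚ)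
                , N , λ n N≤n → subst (λ y → ∣ y ∣ ℚ.≤ ∣ seq x N ∣ ℚ.+ 1ℚ)
                    (solveℚ 2 (λ a b → a :+ (b :- a) := b) refl (seq x N) (seq x n))
                    (ℚ.≤-trans (ℚ.∣p+q∣≤∣p∣+∣q∣ (seq x N) (seq x n ℚ.- seq x N))
                      (ℚ.+-monoʳ-≤ ∣ seq x N ∣ (close n N N≤n ℕ.≤-refl)))

fromℚ : ℚ → ℝ
fromℚ q .seq    _       = q
fromℚ q .cauchy ε 0<ε = 0 , λ _ _ _ _ →
  subst (λ y → ∣ y ∣ ℚ.≤ ε) (sym (ℚ.+-inverseʳ q)) (ℚ.<⇒≤ 0<ε)

fromℕ : ℕ → ℝ
fromℕ n = fromℚ (ℤ.+ n ℚ./ 1)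

infixl 6 _+ᴿ_
infixl 7 _*ᴿ_
infixl 6 _⊔ᴿ_

_+ᴿ_ : ℝ → ℝ → ℝ
(x +ᴿ y) .seq n = seq x n ℚ.+ seq y n
(x +ᴿ y) .cauchy ε 0<ε
  with cauchy x (½ ℚ.* ε) (½*-pos 0<ε) | cauchy y (½ ℚ.* ε) (½*-pos 0<ε)
... | M , closeˣ | N , closeʸ = M ℕ.⊔ N , λ m n ≤m ≤n →
  subst₂ (λ a b → ∣ a ∣ ℚ.≤ b)
    (solveℚ 4 (λ a b c d → (a :- c) :+ (b :- d) := (a :+ b) :- (c :+ d)) refl
      (seq x m) (seq y m) (seq x n) (seq y n))
    (half+half ε)
    (ℚ.≤-trans (ℚ.∣p+q∣≤∣p∣+∣q∣ (seq x m ℚ.- seq x n) (seq y m ℚ.- seq y n))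
      (ℚ.+-mono-≤ (closeˣ m n (⊔ˡ ≤m) (⊔ˡ ≤n)) (closeʸ m n (⊔ʳ ≤m) (⊔ʳ ≤n))))

_⊔ᴿ_ : ℝ → ℝ → ℝ
(x ⊔ᴿ y) .seq n = seq x n ℚ.⊔ seq y n
(x ⊔ᴿ y) .cauchy ε 0<ε with cauchy x ε 0<ε | cauchy y ε 0<ε
... | M , closeˣ | N , closeʸ = M ℕ.⊔ N , λ m n ≤m ≤n →
  ⊔-close (seq x m) (seq y m) (seq x n) (seq y n)
    (closeˣ m n (⊔ˡ ≤m) (⊔ˡ ≤n)) (closeʸ m n (⊔ʳ ≤m) (⊔ʳ ≤n))

_*ᴿ_ : ℝ → ℝ → ℝ
(x *ᴿ y) .seq n = seq x n ℚ.* seq y n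
(x *ᴿ y) .cauchy ε 0<ε = product (bounded x) (bounded y)
  where
  Cauchy : Set
  Cauchy = ∃[ N ] ∀ m n → N ℕ.≤ m → N ℕ.≤ n →
           ∣ seq x m ℚ.* seq y m ℚ.- seq x n ℚ.* seq y n ∣ ℚ.≤ ε

  product : (∃[ B ] 0ℚ ℚ.< B × (∃[ N ] ∀ n → N ℕ.≤ n → ∣ seq x n ∣ ℚ.≤ B)) →
            (∃[ B ] 0ℚ ℚ.< B × (∃[ N ] ∀ n → N ℕ.≤ n → ∣ seq y n ∣ ℚ.≤ B)) →
            Cauchy
  product (B , 0<B , K , ∣x∣≤B) (C , 0<C , L , ∣y∣≤C) =
    conclude (cauchy x η 0<η) (cauchy y η 0<η)
    where
    0<D : 0ℚ ℚ.< B ℚ.+ C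
    0<D = ℚ.+-mono-< 0<B 0<C

    instance
      D-pos : ℚ.Positive (B ℚ.+ C)
      D-pos = ℚ.positive 0<D
      D-nonZero : ℚ.NonZero (B ℚ.+ C)
      D-nonZero = ℚ.pos⇒nonZero (B ℚ.+ C)

    η : ℚ
    η = ℚ.1/ (B ℚ.+ C) ℚ.* ε

    0<η : 0ℚ ℚ.< η
    0<η = *-pos (ℚ.positive⁻¹ (ℚ.1/ (B ℚ.+ C)) {{ℚ.1/pos⇒pos (B ℚ.+ C)}}) 0<ε

    Bη+Cη≡ε : B ℚ.* η ℚ.+ C ℚ.* η ≡ ε
    Bη+Cη≡ε = trans (sym (ℚ.*-distribʳ-+ η B C))
      (trans (sym (ℚ.*-assoc (B ℚ.+ C) (ℚ.1/ (B ℚ.+ C)) ε))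
      (trans (cong (ℚ._* ε) (ℚ.*-inverseʳ (B ℚ.+ C))) (ℚ.*-identityˡ ε)))

    conclude :
      (∃[ N ] ∀ m n → N ℕ.≤ m → N ℕ.≤ n → ∣ seq x m ℚ.- seq x n ∣ ℚ.≤ η) →
      (∃[ N ] ∀ m n → N ℕ.≤ m → N ℕ.≤ n → ∣ seq y m ℚ.- seq y n ∣ ℚ.≤ η) →
      Cauchy
    conclude (M , closeˣ) (N , closeʸ) = (K ℕ.⊔ L) ℕ.⊔ (M ℕ.⊔ N) , λ m n ≤m ≤n →
      let KL≤m = ⊔ˡ {K ℕ.⊔ L} ≤m ; MN≤m = ⊔ʳ {K ℕ.⊔ L} ≤m
          KL≤n = ⊔ˡ {K ℕ.⊔ L} ≤n ; MN≤n = ⊔ʳ {K ℕ.⊔ L} ≤n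
      in subst₂ (λ a b → ∣ a ∣ ℚ.≤ b)
        (solveℚ 4 (λ a b c d → a :* (b :- d) :+ d :* (a :- c) := a :* b :- c :* d)
          refl (seq x m) (seq y m) (seq x n) (seq y n))
        Bη+Cη≡ε
        (ℚ.≤-trans
          (ℚ.∣p+q∣≤∣p∣+∣q∣ (seq x m ℚ.* (seq y m ℚ.- seq y n))
                           (seq y n ℚ.* (seq x m ℚ.- seq x n)))
          (ℚ.+-mono-≤
            (term (seq x m) (seq y m ℚ.- seq y n)
              (∣x∣≤B m (⊔ˡ KL≤m)) 0<B (closeʸ m n (⊔ʳ MN≤m) (⊔ʳ MN≤n)))
            (term (seq y n) (seq x m ℚ.- seq x n)
              (∣y∣≤C n (⊔ʳ KL≤n)) 0<C (closeˣ m n (⊔ˡ MN≤m) (⊔ˡ MN≤n)))))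
      where
      term : ∀ p q {A} → ∣ p ∣ ℚ.≤ A → 0ℚ ℚ.< A → ∣ q ∣ ℚ.≤ η →
             ∣ p ℚ.* q ∣ ℚ.≤ A ℚ.* η
      term p q {A} p≤ 0<A q≤ =
        subst (ℚ._≤ A ℚ.* η) (sym (ℚ.∣p*q∣≡∣p∣*∣q∣ p q))
          (*-mono (ℚ.0≤∣p∣ q) (ℚ.<⇒≤ 0<A) p≤ q≤)

-- 1/q for q ≥ c > 0, totalised by truncating q at c from below.
recip⊔ : ∀ {c} → 0ℚ ℚ.< c → ℚ → ℚ
recip⊔ {c} 0<c q = ℚ.1/_ (c ℚ.⊔ q)
  {{ℚ.pos⇒nonZero (c ℚ.⊔ q) {{ℚ.positive (ℚ.<-≤-trans 0<c (ℚ.p≤p⊔q c q))}}}}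

recip⊔-close : ∀ {c} (0<c : 0ℚ ℚ.< c) {p q ε} → 0ℚ ℚ.< ε →
               ∣ p ℚ.- q ∣ ℚ.≤ ε ℚ.* (c ℚ.* c) →
               ∣ recip⊔ 0<c p ℚ.- recip⊔ 0<c q ∣ ℚ.≤ ε
recip⊔-close {c} 0<c {p} {q} {ε} 0<ε close =
  ℚ.*-cancelʳ-≤-pos (u ℚ.* v) {{ℚ.positive 0<uv}}
    (subst (ℚ._≤ ε ℚ.* (u ℚ.* v)) (sym scaled)
      (ℚ.≤-trans ∣v-u∣≤
        (ℚ.*-monoˡ-≤-nonNeg ε {{ℚ.nonNegative (ℚ.<⇒≤ 0<ε)}}
          (*-mono (ℚ.<⇒≤ 0<c) (ℚ.<⇒≤ 0<u) (ℚ.p≤p⊔q c p) (ℚ.p≤p⊔q c q)))))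
  where
  u v : ℚ
  u = c ℚ.⊔ p
  v = c ℚ.⊔ q

  0<u : 0ℚ ℚ.< u
  0<u = ℚ.<-≤-trans 0<c (ℚ.p≤p⊔q c p)
  0<v : 0ℚ ℚ.< v
  0<v = ℚ.<-≤-trans 0<c (ℚ.p≤p⊔q c q)
  0<uv : 0ℚ ℚ.< u ℚ.* v
  0<uv = *-pos 0<u 0<v

  1/u 1/v : ℚ
  1/u = recip⊔ 0<c p
  1/v = recip⊔ 0<c q

  1/u*u : 1/u ℚ.* u ≡ 1ℚ
  1/u*u = ℚ.*-inverseˡ u {{ℚ.pos⇒nonZero u {{ℚ.positive 0<u}}}}
  1/v*v : 1/v ℚ.* v ≡ 1ℚ
  1/v*v = ℚ.*-inverseˡ v {{ℚ.pos⇒nonZero v {{ℚ.positive 0<v}}}}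

  [1/u-1/v]uv : (1/u ℚ.- 1/v) ℚ.* (u ℚ.* v) ≡ v ℚ.- u
  [1/u-1/v]uv = trans
    (solveℚ 4 (λ a b u v → (a :- b) :* (u :* v) := (a :* u) :* v :- (b :* v) :* u)
      refl 1/u 1/v u v)
    (cong₂ ℚ._-_
      (trans (cong (ℚ._* v) 1/u*u) (ℚ.*-identityˡ v))
      (trans (cong (ℚ._* u) 1/v*v) (ℚ.*-identityˡ u)))

  scaled : ∣ 1/u ℚ.- 1/v ∣ ℚ.* (u ℚ.* v) ≡ ∣ v ℚ.- u ∣
  scaled = trans
    (cong (∣ 1/u ℚ.- 1/v ∣ ℚ.*_) (sym (ℚ.0≤p⇒∣p∣≡p (ℚ.<⇒≤ 0<uv))))
    (trans (sym (ℚ.∣p*q∣≡∣p∣*∣q∣ (1/u ℚ.- 1/v) (u ℚ.* v))) (cong ∣_∣ [1/u-1/v]uv))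

  0≤εcc : 0ℚ ℚ.≤ ε ℚ.* (c ℚ.* c)
  0≤εcc = ℚ.<⇒≤ (*-pos 0<ε (*-pos 0<c 0<c))

  ∣v-u∣≤ : ∣ v ℚ.- u ∣ ℚ.≤ ε ℚ.* (c ℚ.* c)
  ∣v-u∣≤ = ⊔-close c q c p
    (subst (λ y → ∣ y ∣ ℚ.≤ ε ℚ.* (c ℚ.* c)) (sym (ℚ.+-inverseʳ c)) 0≤εcc)
    (subst (ℚ._≤ ε ℚ.* (c ℚ.* c)) (∣p-q∣≡∣q-p∣ p q) close)

-- The n-th approximation is 1 / (c ⊔ xₙ), where c > 0 is the eventual lower
-- bound of x given by its positivity; this is 1 / xₙ for all large n.
recip : (x : ℝ) → Positiveᴿ x → ℝ
recip x (c , 0<c , _) .seq n = recip⊔ 0<c (seq x n)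
recip x (c , 0<c , _) .cauchy ε 0<ε
  with cauchy x (ε ℚ.* (c ℚ.* c)) (*-pos 0<ε (*-pos 0<c 0<c))
... | N , close = N , λ m n ≤m ≤n → recip⊔-close 0<c 0<ε (close m n ≤m ≤n)

divide : (x y : ℝ) → Positiveᴿ y → ℝ
divide x y 0<y = x *ᴿ recip y 0<y

fromℚ-pos : ∀ {q} → 0ℚ ℚ.< q → Positiveᴿ (fromℚ q)
fromℚ-pos {q} 0<q = q , 0<q , 0 , λ _ _ → ℚ.≤-refl

fromℕ-pos : ∀ n .{{_ : NonZero n}} → Positiveᴿ (fromℕ n)
fromℕ-pos n = fromℚ-pos (ℚ.positive⁻¹ (ℤ.+ n ℚ./ 1) {{ℚ.normalize-pos n 1}})

*ᴿ-pos : ∀ x y → Positiveᴿ x → Positiveᴿ y → Positiveᴿ (x *ᴿ y)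
*ᴿ-pos x y (c , 0<c , M , c≤x) (d , 0<d , N , d≤y) =
  c ℚ.* d , *-pos 0<c 0<d , M ℕ.⊔ N , λ n ≤n →
  *-mono (ℚ.<⇒≤ 0<d) (ℚ.≤-trans (ℚ.<⇒≤ 0<c) (c≤x n (⊔ˡ ≤n)))
    (c≤x n (⊔ˡ ≤n)) (d≤y n (⊔ʳ ≤n))

pos⇒nonNegᴿ : ∀ x → Positiveᴿ x → NonNegativeᴿ x
pos⇒nonNegᴿ x (c , 0<c , N , c≤x) = N , λ n ≤n → ℚ.≤-trans (ℚ.<⇒≤ 0<c) (c≤x n ≤n)

*ᴿ-nonNeg : ∀ x y → NonNegativeᴿ x → NonNegativeᴿ y → NonNegativeᴿ (x *ᴿ y)
*ᴿ-nonNeg x y (M , 0≤x) (N , 0≤y) = M ℕ.⊔ N , λ n ≤n →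
  *-nonNeg (0≤x n (⊔ˡ ≤n)) (0≤y n (⊔ʳ ≤n))

+ᴿ-pos : ∀ x y → Positiveᴿ x → NonNegativeᴿ y → Positiveᴿ (x +ᴿ y)
+ᴿ-pos x y (c , 0<c , M , c≤x) (N , 0≤y) = c , 0<c , M ℕ.⊔ N , λ n ≤n →
  ℚ.≤-trans (p≤p+ε (0≤y n (⊔ʳ ≤n))) (ℚ.+-monoˡ-≤ (seq y n) (c≤x n (⊔ˡ ≤n)))

------------------------------------------------------------------------
-- π by the Leibniz series

odd⁻¹ : ℕ → ℚ
odd⁻¹ k = ℤ.1ℤ ℚ./ suc (2 ℕ.* k)

-- l terms of  1/(2k+1) − 1/(2k+3) + 1/(2k+5) − ⋯ , bracketed to the right.
alternating : ℕ → ℕ → ℚ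
alternating k zero    = 0ℚ
alternating k (suc l) = odd⁻¹ k ℚ.- alternating (suc k) l

/-≤ : ∀ i j m n → i ℤ.* ℤ.+ suc n ℤ.≤ j ℤ.* ℤ.+ suc m →
      i ℚ./ suc m ℚ.≤ j ℚ./ suc n
/-≤ i j m n h = ℚ.toℚᵘ-cancel-≤
  (ℚᵘ.≤-respˡ-≃ (ℚᵘ.≃-sym (ℚ.toℚᵘ-fromℚᵘ (ℚᵘ.mkℚᵘ i m)))
    (ℚᵘ.≤-respʳ-≃ (ℚᵘ.≃-sym (ℚ.toℚᵘ-fromℚᵘ (ℚᵘ.mkℚᵘ j n))) (ℚᵘ.*≤* h)))

1/-antitone : ∀ {m n} → n ℕ.≤ m → ℤ.1ℤ ℚ./ suc m ℚ.≤ ℤ.1ℤ ℚ./ suc n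
1/-antitone {m} {n} n≤m = /-≤ ℤ.1ℤ ℤ.1ℤ m n
  (ℤ.*-monoˡ-≤-nonNeg ℤ.1ℤ (ℤ.+≤+ (s≤s n≤m)))

odd⁻¹-antitone : ∀ {k l} → k ℕ.≤ l → odd⁻¹ l ℚ.≤ odd⁻¹ k
odd⁻¹-antitone k≤l = 1/-antitone (ℕ.*-monoʳ-≤ 2 k≤l)

0≤odd⁻¹ : ∀ k → 0ℚ ℚ.≤ odd⁻¹ k
0≤odd⁻¹ k = ℚ.nonNegative⁻¹ (odd⁻¹ k) {{ℚ.normalize-nonNeg 1 (suc (2 ℕ.* k))}}

odd⁻¹-small : ∀ ε → 0ℚ ℚ.< ε → ∃[ N ] odd⁻¹ N ℚ.≤ ε
odd⁻¹-small ε@(ℚ.mkℚ ℤ.+[1+ a ] d _) _ = d , ℚ.≤-trans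
  (1/-antitone (ℕ.m≤n*m d 2))
  (subst (ℤ.1ℤ ℚ./ suc d ℚ.≤_) (ℚ.↥p/↧p≡p ε)
    (/-≤ ℤ.1ℤ ℤ.+[1+ a ] d d (ℤ.*-monoʳ-≤-nonNeg (ℤ.+ suc d) (ℤ.+≤+ (s≤s (z≤n {a}))))))
odd⁻¹-small (ℚ.mkℚ (ℤ.+ 0) _ _) (ℚ.*<* (ℤ.+<+ ()))
odd⁻¹-small (ℚ.mkℚ (ℤ.-[1+ _ ]) _ _) (ℚ.*<* ())

p-q≤p : ∀ {p q} → 0ℚ ℚ.≤ q → p ℚ.- q ℚ.≤ p
p-q≤p {p} {q} 0≤q = p≤q+⇒p-q≤ p q (subst (p ℚ.≤_) (ℚ.+-comm p q) (p≤p+ε 0≤q))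

p≤q⇒0≤q-p : ∀ {p q} → p ℚ.≤ q → 0ℚ ℚ.≤ q ℚ.- p
p≤q⇒0≤q-p {p} {q} h = subst (ℚ._≤ q ℚ.- p) (ℚ.+-inverseʳ p) (ℚ.+-monoˡ-≤ (ℚ.- p) h)

alternating-bounds : ∀ k l → 0ℚ ℚ.≤ alternating k l × alternating k l ℚ.≤ odd⁻¹ k
alternating-bounds k zero    = ℚ.≤-refl , 0≤odd⁻¹ k
alternating-bounds k (suc l) with alternating-bounds (suc k) l
... | 0≤rest , rest≤ =
  p≤q⇒0≤q-p (ℚ.≤-trans rest≤ (odd⁻¹-antitone (ℕ.n≤1+n k))) , p-q≤p 0≤rest

alternating-tail : ∀ k n l →
  ∣ alternating k (n ℕ.+ l) ℚ.- alternating k n ∣ ℚ.≤ odd⁻¹ (n ℕ.+ k)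
alternating-tail k zero l =
  subst (ℚ._≤ odd⁻¹ k)
    (sym (trans (cong ∣_∣ (ℚ.+-identityʳ (alternating k l)))
                (ℚ.0≤p⇒∣p∣≡p (proj₁ (alternating-bounds k l)))))
    (proj₂ (alternating-bounds k l))
alternating-tail k (suc n) l =
  subst₂ (λ a b → a ℚ.≤ odd⁻¹ b)
    (trans (∣p-q∣≡∣q-p∣ (alternating (suc k) (n ℕ.+ l)) (alternating (suc k) n))
      (cong ∣_∣ (solveℚ 3 (λ a s t → t :- s := (a :- s) :- (a :- t)) refl
        (odd⁻¹ k) (alternating (suc k) (n ℕ.+ l)) (alternating (suc k) n))))
    (ℕ.+-suc n k)
    (alternating-tail (suc k) n l)

π/4 : ℝ
π/4 .seq = alternating 0
π/4 .cauchy ε 0<ε = N , close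
  where
  N : ℕ
  N = proj₁ (odd⁻¹-small ε 0<ε)

  ordered : ∀ {m n} → N ℕ.≤ n → n ℕ.≤ m →
            ∣ alternating 0 m ℚ.- alternating 0 n ∣ ℚ.≤ ε
  ordered {m} {n} N≤n n≤m = ℚ.≤-trans
    (subst (λ i → ∣ alternating 0 i ℚ.- alternating 0 n ∣ ℚ.≤ odd⁻¹ (n ℕ.+ 0))
      (ℕ.m+[n∸m]≡n n≤m) (alternating-tail 0 n (m ℕ.∸ n)))
    (ℚ.≤-trans (odd⁻¹-antitone (ℕ.≤-trans N≤n (ℕ.m≤m+n n 0)))
      (proj₂ (odd⁻¹-small ε 0<ε)))

  close : ∀ m n → N ℕ.≤ m → N ℕ.≤ n → ∣ alternating 0 m ℚ.- alternating 0 n ∣ ℚ.≤ ε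
  close m n N≤m N≤n with ℕ.≤-total n m
  ... | inj₁ n≤m = ordered N≤n n≤m
  ... | inj₂ m≤n = subst (ℚ._≤ ε)
    (∣p-q∣≡∣q-p∣ (alternating 0 n) (alternating 0 m)) (ordered N≤m m≤n)

π : ℝ
π = fromℕ 4 *ᴿ π/4

π-pos : Positiveᴿ π
π-pos = *ᴿ-pos (fromℕ 4) π/4 (fromℕ-pos 4)
  (⅔ , ℚ.positive⁻¹ ⅔ , 1 , λ { (suc n) _ → ℚ.+-monoʳ-≤ 1ℚ
    (ℚ.neg-antimono-≤ (proj₂ (alternating-bounds 1 n))) })
  where
  ⅔ : ℚ
  ⅔ = 1ℚ ℚ.- odd⁻¹ 1

------------------------------------------------------------------------
-- The lower bound

β-nonNeg : ∀ {p} (H : GapSequence p) n .{{_ : NonZero n}} s → 0ℚ ℚ.≤ β H n s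
β-nonNeg {p} H n s = v≤min⁺ (0≤δ 1)
  (All.map⁺ (All.universal (0≤δ ∘ suc) (List.upTo (n ℕ.∸ 1))))
  where
  open GapSequence H
  0≤δ : ∀ k → 0ℚ ℚ.≤ δ H n s k
  0≤δ k = ⊥≤max 0ℚ
    (List.map (λ j → ‖ ℤ.+ (k ℕ.* gap j) ℚ./ n ‖)
              (List.filter (Fin._<? s) (List.allFin p)))

module _ {p} (H : GapSequence p) (n : ℕ) .{{_ : NonZero n}} (s : Fin p) where

  open GapSequence H

  denominator : ℝ
  denominator =
    fromℕ 8 *ᴿ π *ᴿ (fromℕ (gap s) +ᴿ π *ᴿ fromℕ n *ᴿ fromℚ (β H n s))

  denominator-pos : Positiveᴿ denominator
  denominator-pos = *ᴿ-pos (fromℕ 8 *ᴿ π)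
    (fromℕ (gap s) +ᴿ π *ᴿ fromℕ n *ᴿ fromℚ (β H n s))
    (*ᴿ-pos (fromℕ 8) π (fromℕ-pos 8) π-pos)
    (+ᴿ-pos (fromℕ (gap s)) (π *ᴿ fromℕ n *ᴿ fromℚ (β H n s))
      (fromℕ-pos (gap s) {{positive s}})
      (*ᴿ-nonNeg (π *ᴿ fromℕ n) (fromℚ (β H n s))
        (pos⇒nonNegᴿ (π *ᴿ fromℕ n) (*ᴿ-pos π (fromℕ n) π-pos (fromℕ-pos n)))
        (0 , λ _ _ → β-nonNeg H n s)))

  lowerBound : ℝ
  lowerBound = divide (fromℕ (n ℕ.^ 2)) denominator denominator-pos

-- The maximum over 1 ≤ s < p. All its terms are positive, so the starting
-- value 0 only matters for the empty range p = 1.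
maxLowerBound : ∀ {p} → GapSequence p → (n : ℕ) .{{_ : NonZero n}} → ℝ
maxLowerBound {p} H n = List.foldr _⊔ᴿ_ (fromℕ 0)
  (List.map (lowerBound H n)
            (List.filter (λ s → 1 ℕ.≤? toℕ s) (List.allFin p)))

{-# OPTIONS --safe #-}

-- Let k attain the minimum in β, put g = gcd n k, n = g d and k = g κ, and let
-- n β = g r. Call the keys below α = ⌊d/2⌋ g small, and place them on the
-- positions i for which x = (κ i + t) mod d lies in the arc [0 , ⌊d/2⌋).
--
-- An exchange moves a small key from i + h to i. For the gaps h before gap s
-- this turns x by at most r steps, so it changes by at most 2r the sum over the
-- small keys of a tent function on ℤ/d centred on the arc. Since each x is
-- taken g times, if E₁ exchanges take ρ small keys out of the arc then
-- ρ² ≤ 2gr E₁. For the remaining gaps h ≤ gap s, the sum of 2i + 1 shows in the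
-- same way that bringing q small keys from positions ≥ α down to the initial
-- segment takes E₂ exchanges with q² ≤ gap s E₂. If m small keys start at
-- positions ≥ α then m ≤ ρ + q, whence m² ≤ (2gr + gap s)(E₁ + E₂). Averaging
-- over the rotation t gives some m ≥ 2n/9, so 4n² ≤ 81 (2nβ + gap s) W, and
-- π ≥ 8/3 makes this stronger than the bound required.

module Submission where

open import Defs
open import Algebra.Properties.Semiring.Sum using ()
open import Data.Bool.Base using (if_then_else_)
open import Data.Fin.Base as Fin using (Fin; toℕ; zero; suc)
import Data.Fin.Permutation as Perm
open import Data.Fin.Permutation.Components using (transpose; transpose-inverse)
import Data.Fin.Properties as Fin
import Data.Integer.Base as ℤ
import Data.Integer.Properties as ℤ
open import Data.Integer.Solver using (module +-*-Solver)
open import Data.List.Base as List using (List; []; _∷_; _∷ʳ_)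
import Data.List.Extrema
import Data.List.Extrema.Nat as Nat
open import Data.List.Membership.Propositional using (_∈_)
open import Data.List.Membership.Propositional.Properties
  using (∈-map⁺; ∈-map⁻; ∈-upTo⁻; ∈-filter⁺; ∈-cartesianProductWith⁺; ∈-allFin)
import Data.List.Properties as List
open import Data.List.Relation.Unary.All as All using (All; []; _∷_)
import Data.List.Relation.Unary.All.Properties as All
import Data.List.Relation.Unary.Any as Any
open import Data.Nat.Base
  using (ℕ; zero; suc; _+_; _*_; _∸_; _/_; _%_; _⊓_; _⊔_; _^_; pred; _≤_; _<_; z≤n; s≤s; s≤s⁻¹;
         NonZero; >-nonZero)
open import Data.Nat.Coprimality using (Coprime; coprime-divisor)
open import Data.Nat.Divisibility using (_∣_; divides; ∣⇒≤; ∣1⇒≡1; *-cancelʳ-∣; *-monoˡ-∣)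
open import Data.Nat.DivMod
open import Data.Nat.GCD using (gcd; gcd[m,n]∣m; gcd[m,n]∣n; gcd-greatest)
open import Data.Nat.Properties as ℕ using (_≟_; _≤?_; _<?_)
open import Data.Nat.Tactic.RingSolver using (solve-∀)
open import Data.Product.Base using (_×_; _,_; proj₁; proj₂; map₂; ∃-syntax)
open import Data.Rational.Base as ℚ using (ℚ; 0ℚ)
import Data.Rational.Properties as ℚ
import Data.Rational.Solver
import Data.Rational.Unnormalised.Base as ℚᵘ
import Data.Rational.Unnormalised.Properties as ℚᵘ
open import Data.Sum.Base using (_⊎_; inj₁; inj₂)
open import Data.Vec.Base as Vec using (Vec; []; _∷_)
import Data.Vec.Properties as Vec
open import Data.Vec.Relation.Unary.Unique.Propositional using (Unique)
import Data.Vec.Relation.Unary.Unique.Propositional.Properties as Unique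
open import Function.Base using (_∘_)
open import Function.Definitions using (Injective)
open import Relation.Binary.Bundles using (DecTotalOrder)
open import Relation.Binary.PropositionalEquality
open import Relation.Nullary using (¬_; Dec; yes; no; does; ¬?; _×-dec_; contradiction)
open import Relation.Nullary.Decidable using (from-yes)

open Algebra.Properties.Semiring.Sum ℕ.+-*-semiring
  using (sum; sum-syntax; sum-cong-≗; ∑-distrib-+; ∑-comm; sum-permute; *-distribˡ-sum; *-distribʳ-sum)
open +-*-Solver using (_:+_; _:*_; _:-_; :-_; _:=_; con) renaming (solve to solveℤ)
open Data.Rational.Solver.+-*-Solver using () renaming
  (_:+_ to _+ℚ_; _:*_ to _·ℚ_; _:=_ to _≔_; con to conℚ; solve to solveℚ)

-- Counting by sums of indicators

-- The squares come from crowding. At most `2 * g` positions of the arc, or of its complement, share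
-- a depth, so ρ small keys outside the arc sit at average depth of order ρ/g, and the ρ places they
-- left empty are equally deep. The tent sum has then risen by order ρ²/g, at most 2r per exchange.
-- The sum of 2i + 1 behaves likewise, with one position per depth on each side of α. Keeping both
-- estimates in squared form lets them combine by Cauchy-Schwarz without square roots.
--
-- The constant: the mean share of keys that are small and start at positions ≥ α is ⌊d/2⌋(d -
-- ⌊d/2⌋)/d², which is smallest, namely 2/9, at d = 3. Hence the factor (9/2)² = 81/4, which lies
-- below 8 · 8/3 = 64/3. Every Leibniz partial sum with at least one term is already ≥ 2/3, so the
-- bound is proved for each rational approximant and no limit is taken.

𝟙 : {P : Set} → Dec P → ℕ
𝟙 P? = if does P? then 1 else 0

𝟙≤1 : {P : Set} (P? : Dec P) → 𝟙 P? ≤ 1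
𝟙≤1 (yes _) = ℕ.≤-refl
𝟙≤1 (no  _) = z≤n

𝟙-true : {P : Set} (P? : Dec P) → P → 𝟙 P? ≡ 1
𝟙-true (yes _) _ = refl
𝟙-true (no ¬p) p = contradiction p ¬p

𝟙-false : {P : Set} (P? : Dec P) → ¬ P → 𝟙 P? ≡ 0
𝟙-false (yes p) ¬p = contradiction p ¬p
𝟙-false (no _)  _  = refl

𝟙-mono : {P Q : Set} (P? : Dec P) (Q? : Dec Q) → (P → Q) → 𝟙 P? ≤ 𝟙 Q?
𝟙-mono (no _)  _  _ = z≤n
𝟙-mono (yes p) Q? f = ℕ.≤-reflexive (sym (𝟙-true Q? (f p)))

𝟙-cong : {P Q : Set} (P? : Dec P) (Q? : Dec Q) → (P → Q) → (Q → P) → 𝟙 P? ≡ 𝟙 Q?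
𝟙-cong P? Q? f g = ℕ.≤-antisym (𝟙-mono P? Q? f) (𝟙-mono Q? P? g)

𝟙-∪ : {P Q R : Set} (P? : Dec P) (Q? : Dec Q) (R? : Dec R) → (P → Q ⊎ R) →
      𝟙 P? ≤ 𝟙 Q? + 𝟙 R?
𝟙-∪ (no _)  _  _  _ = z≤n
𝟙-∪ (yes p) Q? R? f with f p
... | inj₁ q = ℕ.≤-trans (ℕ.≤-reflexive (sym (𝟙-true Q? q))) (ℕ.m≤m+n _ _)
... | inj₂ r = ℕ.≤-trans (ℕ.≤-reflexive (sym (𝟙-true R? r))) (ℕ.m≤n+m _ (𝟙 Q?))

𝟙+𝟙¬ : {P : Set} (P? : Dec P) → 𝟙 P? + 𝟙 (¬? P?) ≡ 1
𝟙+𝟙¬ (yes _) = refl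
𝟙+𝟙¬ (no  _) = refl

𝟙-× : {P Q : Set} (P? : Dec P) (Q? : Dec Q) → 𝟙 P? * 𝟙 Q? ≡ 𝟙 (P? ×-dec Q?)
𝟙-× (yes _) Q? = ℕ.+-identityʳ _
𝟙-× (no  _) _  = refl

sum-mono-≤ : ∀ {n} {f g : Fin n → ℕ} → (∀ i → f i ≤ g i) → sum f ≤ sum g
sum-mono-≤ {zero}  f≤g = z≤n
sum-mono-≤ {suc n} f≤g = ℕ.+-mono-≤ (f≤g zero) (sum-mono-≤ (f≤g ∘ suc))

sum-const : ∀ n c → ∑[ i < n ] c ≡ n * c
sum-const zero    c = refl
sum-const (suc n) c = cong (c +_) (sum-const n c)

sum-𝟙≟≤1 : ∀ {n} {f : Fin n → ℕ} → Injective _≡_ _≡_ f → ∀ v →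
           ∑[ i < n ] 𝟙 (f i ≟ v) ≤ 1
sum-𝟙≟≤1 {zero}  inj v = z≤n
sum-𝟙≟≤1 {suc n} {f} inj v = first (f zero ≟ v) (sum-𝟙≟≤1 (λ eq → Fin.suc-injective (inj eq)) v)
  (λ f0≡v → trans
    (sum-cong-≗ {n} (λ i → 𝟙-false (f (suc i) ≟ v) (λ fi≡v → Fin.0≢1+n (inj (trans f0≡v (sym fi≡v))))))
    (trans (sum-const n 0) (ℕ.*-zeroʳ n)))
  where
  first : {A : Set} (A? : Dec A) {m : ℕ} → m ≤ 1 → (A → m ≡ 0) → 𝟙 A? + m ≤ 1
  first (no  _) m≤1 _   = m≤1
  first (yes a) _   m≡0 = ℕ.≤-reflexive (cong suc (m≡0 a))

count-interval : ∀ {n} {f : Fin n → ℕ} → Injective _≡_ _≡_ f → ∀ b m →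
                 ∑[ i < n ] 𝟙 ((b ≤? f i) ×-dec (f i <? b + m)) ≤ m
count-interval {n} {f} inj b zero = ℕ.≤-reflexive (trans
  (sum-cong-≗ {n} (λ i → 𝟙-false ((b ≤? f i) ×-dec (f i <? b + 0))
    (λ (b≤ , <b) → ℕ.<⇒≱ (subst (f i <_) (ℕ.+-identityʳ b) <b) b≤)))
  (trans (sum-const n 0) (ℕ.*-zeroʳ n)))
count-interval {n} {f} inj b (suc m) = begin
  ∑[ i < n ] 𝟙 ((b ≤? f i) ×-dec (f i <? b + suc m))
    ≤⟨ sum-mono-≤ {n} (λ i → 𝟙-∪ ((b ≤? f i) ×-dec (f i <? b + suc m))
         ((b ≤? f i) ×-dec (f i <? b + m)) (f i ≟ b + m) (split i)) ⟩
  ∑[ i < n ] (𝟙 ((b ≤? f i) ×-dec (f i <? b + m)) + 𝟙 (f i ≟ b + m))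
    ≡⟨ ∑-distrib-+ {n} (λ i → 𝟙 ((b ≤? f i) ×-dec (f i <? b + m))) (λ i → 𝟙 (f i ≟ b + m)) ⟩
  ∑[ i < n ] 𝟙 ((b ≤? f i) ×-dec (f i <? b + m)) + ∑[ i < n ] 𝟙 (f i ≟ b + m)
    ≤⟨ ℕ.+-mono-≤ (count-interval inj b m) (sum-𝟙≟≤1 inj (b + m)) ⟩
  m + 1
    ≡⟨ ℕ.+-comm m 1 ⟩
  suc m ∎
  where
  open ℕ.≤-Reasoning
  split : ∀ i → b ≤ f i × f i < b + suc m → (b ≤ f i × f i < b + m) ⊎ (f i ≡ b + m)
  split i (b≤ , <sm) with ℕ.m<1+n⇒m<n∨m≡n (subst (f i <_) (ℕ.+-suc b m) <sm)
  ... | inj₁ <m = inj₁ (b≤ , <m)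
  ... | inj₂ ≡m = inj₂ ≡m

count-injective-≤ : ∀ {n} {f : Fin n → ℕ} → Injective _≡_ _≡_ f →
                    {P : Fin n → Set} (P? : ∀ i → Dec (P i)) → ∀ b m →
                    (∀ i → P i → b ≤ f i × f i < b + m) →
                    ∑[ i < n ] 𝟙 (P? i) ≤ m
count-injective-≤ {n} {f} inj P? b m range = ℕ.≤-trans
  (sum-mono-≤ {n} (λ i → 𝟙-mono (P? i) ((b ≤? f i) ×-dec (f i <? b + m)) (range i)))
  (count-interval inj b m)

-- Rearrangement inequalities

-- Split (∑ ψ)² over the pairs (i , j) with y j < y i and with y i ≤ y j, and
-- transpose the second part: the pairs with a given i then weigh at most
-- ψ i * (μ * y i + μ * suc (y i)).
square≤weighted-sum : ∀ {n} (ψ y : Fin n → ℕ) μ →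
  (∀ l → ∑[ j < n ] (ψ j * 𝟙 (y j <? l)) ≤ μ * l) →
  sum ψ * sum ψ ≤ μ * ∑[ i < n ] (ψ i * suc (2 * y i))
square≤weighted-sum {n} ψ y μ sparse = begin
  sum ψ * sum ψ
    ≡⟨ *-distribʳ-sum (sum ψ) ψ ⟩
  ∑[ i < n ] (ψ i * sum ψ)
    ≡⟨ sum-cong-≗ {n} (λ i → *-distribˡ-sum (ψ i) ψ) ⟩
  ∑[ i < n ] ∑[ j < n ] (ψ i * ψ j)
    ≡⟨ sum-cong-≗ {n} (λ i → trans (sum-cong-≗ {n} (λ j → split i j))
         (∑-distrib-+ {n} (λ j → ψ i * (ψ j * 𝟙 (y j <? y i)))
                          (λ j → ψ j * (ψ i * 𝟙 (y i <? suc (y j)))))) ⟩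
  ∑[ i < n ] (∑[ j < n ] (ψ i * (ψ j * 𝟙 (y j <? y i))) +
              ∑[ j < n ] (ψ j * (ψ i * 𝟙 (y i <? suc (y j)))))
    ≡⟨ ∑-distrib-+ {n} (λ i → ∑[ j < n ] (ψ i * (ψ j * 𝟙 (y j <? y i))))
                       (λ i → ∑[ j < n ] (ψ j * (ψ i * 𝟙 (y i <? suc (y j))))) ⟩
  ∑[ i < n ] ∑[ j < n ] (ψ i * (ψ j * 𝟙 (y j <? y i))) +
  ∑[ i < n ] ∑[ j < n ] (ψ j * (ψ i * 𝟙 (y i <? suc (y j))))
    ≡⟨ cong (∑[ i < n ] ∑[ j < n ] (ψ i * (ψ j * 𝟙 (y j <? y i))) +_)
         (∑-comm {n} {n} (λ i j → ψ j * (ψ i * 𝟙 (y i <? suc (y j))))) ⟩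
  ∑[ i < n ] ∑[ j < n ] (ψ i * (ψ j * 𝟙 (y j <? y i))) +
  ∑[ i < n ] ∑[ j < n ] (ψ i * (ψ j * 𝟙 (y j <? suc (y i))))
    ≡⟨ ∑-distrib-+ {n} (λ i → ∑[ j < n ] (ψ i * (ψ j * 𝟙 (y j <? y i))))
                       (λ i → ∑[ j < n ] (ψ i * (ψ j * 𝟙 (y j <? suc (y i))))) ⟨
  ∑[ i < n ] (∑[ j < n ] (ψ i * (ψ j * 𝟙 (y j <? y i))) +
              ∑[ j < n ] (ψ i * (ψ j * 𝟙 (y j <? suc (y i)))))
    ≤⟨ sum-mono-≤ {n} (λ i → ℕ.+-mono-≤ (below i (y i)) (below i (suc (y i)))) ⟩
  ∑[ i < n ] (ψ i * (μ * y i) + ψ i * (μ * suc (y i)))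
    ≡⟨ sum-cong-≗ {n} (λ i → collect (ψ i) μ (y i)) ⟩
  ∑[ i < n ] (μ * (ψ i * suc (2 * y i)))
    ≡⟨ *-distribˡ-sum {n} μ (λ i → ψ i * suc (2 * y i)) ⟨
  μ * ∑[ i < n ] (ψ i * suc (2 * y i)) ∎
  where
  open ℕ.≤-Reasoning

  collect : ∀ p m z → p * (m * z) + p * (m * suc z) ≡ m * (p * suc (2 * z))
  collect = solve-∀

  below : ∀ i l → ∑[ j < n ] (ψ i * (ψ j * 𝟙 (y j <? l))) ≤ ψ i * (μ * l)
  below i l = ℕ.≤-trans
    (ℕ.≤-reflexive (sym (*-distribˡ-sum {n} (ψ i) (λ j → ψ j * 𝟙 (y j <? l)))))
    (ℕ.*-monoʳ-≤ (ψ i) (sparse l))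

  arrange : ∀ p q a b → p * q * (a + b) ≡ p * (q * a) + q * (p * b)
  arrange = solve-∀

  -- The case y i ≤ y j is written y i < suc (y j), so that after the transposition `sparse` covers
  -- it too, with l = suc (y i).
  one : ∀ a b → 1 ≡ 𝟙 (b <? a) + 𝟙 (a <? suc b)
  one a b = trans (sym (𝟙+𝟙¬ (b <? a)))
    (cong (𝟙 (b <? a) +_) (𝟙-cong (¬? (b <? a)) (a <? suc b)
      (s≤s ∘ ℕ.≮⇒≥) (λ a<sb → ℕ.≤⇒≯ (s≤s⁻¹ a<sb))))

  split : ∀ i j → ψ i * ψ j ≡
          ψ i * (ψ j * 𝟙 (y j <? y i)) + ψ j * (ψ i * 𝟙 (y i <? suc (y j)))
  split i j = trans (sym (ℕ.*-identityʳ (ψ i * ψ j)))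
    (trans (cong (ψ i * ψ j *_) (one (y i) (y j))) (arrange (ψ i) (ψ j) _ _))

module _ {n} {P Q : Fin n → Set} (P? : ∀ i → Dec (P i)) (Q? : ∀ i → Dec (Q i)) where

  ∣_∖_∣ : ℕ
  ∣_∖_∣ = ∑[ i < n ] (𝟙 (P? i) * 𝟙 (¬? (Q? i)))

module _ {n} {P Q : Fin n → Set} (P? : ∀ i → Dec (P i)) (Q? : ∀ i → Dec (Q i))
  (same-size : ∑[ i < n ] 𝟙 (P? i) ≡ ∑[ i < n ] 𝟙 (Q? i)) where

  -- Each difference together with the common part P ∩ Q makes up one of two sets of equal size.
  ∣∖∣-sym : ∣ P? ∖ Q? ∣ ≡ ∣ Q? ∖ P? ∣
  ∣∖∣-sym = ℕ.+-cancelʳ-≡ (∑[ i < n ] (𝟙 (P? i) * 𝟙 (Q? i))) _ _ (begin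
    ∣ P? ∖ Q? ∣ + ∑[ i < n ] (𝟙 (P? i) * 𝟙 (Q? i))
      ≡⟨ ∑-distrib-+ {n} (λ i → 𝟙 (P? i) * 𝟙 (¬? (Q? i))) (λ i → 𝟙 (P? i) * 𝟙 (Q? i)) ⟨
    ∑[ i < n ] (𝟙 (P? i) * 𝟙 (¬? (Q? i)) + 𝟙 (P? i) * 𝟙 (Q? i))
      ≡⟨ sum-cong-≗ {n} (λ i → keepˡ (P? i) (Q? i)) ⟩
    ∑[ i < n ] 𝟙 (P? i)
      ≡⟨ same-size ⟩
    ∑[ i < n ] 𝟙 (Q? i)
      ≡⟨ sum-cong-≗ {n} (λ i → keepʳ (P? i) (Q? i)) ⟨
    ∑[ i < n ] (𝟙 (Q? i) * 𝟙 (¬? (P? i)) + 𝟙 (P? i) * 𝟙 (Q? i))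
      ≡⟨ ∑-distrib-+ {n} (λ i → 𝟙 (Q? i) * 𝟙 (¬? (P? i))) (λ i → 𝟙 (P? i) * 𝟙 (Q? i)) ⟩
    ∣ Q? ∖ P? ∣ + ∑[ i < n ] (𝟙 (P? i) * 𝟙 (Q? i)) ∎)
    where
    open ≡-Reasoning
    keepˡ : {A B : Set} (A? : Dec A) (B? : Dec B) → 𝟙 A? * 𝟙 (¬? B?) + 𝟙 A? * 𝟙 B? ≡ 𝟙 A?
    keepˡ (yes _) (yes _) = refl
    keepˡ (yes _) (no  _) = refl
    keepˡ (no  _) _       = refl
    keepʳ : {A B : Set} (A? : Dec A) (B? : Dec B) → 𝟙 B? * 𝟙 (¬? A?) + 𝟙 A? * 𝟙 B? ≡ 𝟙 B?
    keepʳ (yes _) (yes _) = refl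
    keepʳ (yes _) (no  _) = refl
    keepʳ (no  _) (yes _) = refl
    keepʳ (no  _) (no  _) = refl

  -- Q is a sublevel set of F: level t separates it from its complement, and
  -- 2y + 1 is the distance from that level.
  rearrangement : (F y : Fin n → ℕ) (t μ : ℕ) →
    (∀ i →   Q i → F i + suc (2 * y i) ≡ t) →
    (∀ i → ¬ Q i → F i ≡ t + suc (2 * y i)) →
    (∀ l → ∑[ i < n ] (𝟙 (Q? i) * 𝟙 (y i <? l)) ≤ μ * l) →
    (∀ l → ∑[ i < n ] (𝟙 (¬? (Q? i)) * 𝟙 (y i <? l)) ≤ μ * l) →
    2 * (∣ P? ∖ Q? ∣ * ∣ P? ∖ Q? ∣) + μ * ∑[ i < n ] (𝟙 (Q? i) * F i)
      ≤ μ * ∑[ i < n ] (𝟙 (P? i) * F i)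
  rearrangement F y t μ inside outside sparse-in sparse-out = begin
    2 * (r * r) + μ * ΣQF
      ≡⟨ cong (_+ μ * ΣQF) (cong (r * r +_) (ℕ.+-identityʳ (r * r))) ⟩
    r * r + r * r + μ * ΣQF
      -- One r² is paid by the places of P outside Q, the other by the places of Q that P leaves
      -- empty.
      ≤⟨ ℕ.+-monoˡ-≤ (μ * ΣQF) (ℕ.+-mono-≤ square-out
           (subst (λ q → q * q ≤ μ * Σin) (sym ∣∖∣-sym) square-in)) ⟩
    μ * Σout + μ * Σin + μ * ΣQF
      ≡⟨ collect μ Σout Σin ΣQF ⟩
    μ * (ΣQF + (Σout + Σin))
      ≡⟨ cong (μ *_) (ℕ.+-cancelʳ-≡ (r * t) _ _ balance) ⟨
    μ * ΣPF ∎
    where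
    open ℕ.≤-Reasoning

    r r′ ΣPF ΣQF Σout Σin : ℕ
    r    = ∣ P? ∖ Q? ∣
    r′   = ∣ Q? ∖ P? ∣
    ΣPF  = ∑[ i < n ] (𝟙 (P? i) * F i)
    ΣQF  = ∑[ i < n ] (𝟙 (Q? i) * F i)
    Σout = ∑[ i < n ] (𝟙 (P? i) * 𝟙 (¬? (Q? i)) * suc (2 * y i))
    Σin  = ∑[ i < n ] (𝟙 (Q? i) * 𝟙 (¬? (P? i)) * suc (2 * y i))

    collect : ∀ m a b c → m * a + m * b + m * c ≡ m * (c + (a + b))
    collect = solve-∀

    square-out : r * r ≤ μ * Σout
    square-out = square≤weighted-sum {n} (λ i → 𝟙 (P? i) * 𝟙 (¬? (Q? i))) y μ (λ l →
      ℕ.≤-trans (sum-mono-≤ {n} (λ i → ℕ.*-monoˡ-≤ (𝟙 (y i <? l))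
        (ℕ.≤-trans (ℕ.*-monoˡ-≤ (𝟙 (¬? (Q? i))) (𝟙≤1 (P? i))) (ℕ.≤-reflexive (ℕ.*-identityˡ (𝟙 (¬? (Q? i))))))))
      (sparse-out l))

    square-in : r′ * r′ ≤ μ * Σin
    square-in = square≤weighted-sum {n} (λ i → 𝟙 (Q? i) * 𝟙 (¬? (P? i))) y μ (λ l →
      ℕ.≤-trans (sum-mono-≤ {n} (λ i → ℕ.*-monoˡ-≤ (𝟙 (y i <? l))
        (ℕ.≤-trans (ℕ.*-monoʳ-≤ (𝟙 (Q? i)) (𝟙≤1 (¬? (P? i)))) (ℕ.≤-reflexive (ℕ.*-identityʳ (𝟙 (Q? i)))))))
      (sparse-in l))

    pointwise : {A B : Set} (A? : Dec A) (B? : Dec B) → ∀ f z →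
      (B → f + suc (2 * z) ≡ t) → (¬ B → f ≡ t + suc (2 * z)) →
      𝟙 A? * f + 𝟙 B? * 𝟙 (¬? A?) * t ≡
      𝟙 B? * f + (𝟙 A? * 𝟙 (¬? B?) * suc (2 * z) + 𝟙 B? * 𝟙 (¬? A?) * suc (2 * z))
      + 𝟙 A? * 𝟙 (¬? B?) * t
    pointwise (yes _) (yes _) f z _ _ = sym (ℕ.+-identityʳ _)
    pointwise (no  _) (no  _) f z _ _ = refl
    pointwise (no  _) (yes b) f z in′ _ = trans (cong (1 *_) (sym (in′ b))) (eq f (suc (2 * z)))
      where
      eq : ∀ f w → 1 * (f + w) ≡ 1 * f + 1 * w + 0
      eq = solve-∀
    pointwise (yes _) (no ¬b) f z _ out = trans (cong (λ x → 1 * x + 0) (out ¬b)) (eq t (suc (2 * z)))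
      where
      eq : ∀ t w → 1 * (t + w) + 0 ≡ 1 * w + 0 + 1 * t
      eq = solve-∀

    -- A place of P outside Q carries t + (2y + 1), a place of Q outside P carries t - (2y + 1). The
    -- levels t cancel because there are equally many of both; adding `r * t` on each side avoids
    -- subtraction.
    balance : ΣPF + r * t ≡ ΣQF + (Σout + Σin) + r * t
    balance = begin-equality
      ΣPF + r * t
        ≡⟨ cong (λ q → ΣPF + q * t) ∣∖∣-sym ⟩
      ΣPF + r′ * t
        ≡⟨ cong (ΣPF +_) (*-distribʳ-sum {n} t _) ⟩
      ΣPF + ∑[ i < n ] (𝟙 (Q? i) * 𝟙 (¬? (P? i)) * t)
        ≡⟨ ∑-distrib-+ {n} _ _ ⟨
      ∑[ i < n ] (𝟙 (P? i) * F i + 𝟙 (Q? i) * 𝟙 (¬? (P? i)) * t)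
        ≡⟨ sum-cong-≗ {n} (λ i → pointwise (P? i) (Q? i) (F i) (y i) (inside i) (outside i)) ⟩
      ∑[ i < n ] (𝟙 (Q? i) * F i + (𝟙 (P? i) * 𝟙 (¬? (Q? i)) * suc (2 * y i)
                                  + 𝟙 (Q? i) * 𝟙 (¬? (P? i)) * suc (2 * y i))
                 + 𝟙 (P? i) * 𝟙 (¬? (Q? i)) * t)
        ≡⟨ ∑-distrib-+ {n} _ _ ⟩
      ∑[ i < n ] (𝟙 (Q? i) * F i + (𝟙 (P? i) * 𝟙 (¬? (Q? i)) * suc (2 * y i)
                                  + 𝟙 (Q? i) * 𝟙 (¬? (P? i)) * suc (2 * y i)))
      + ∑[ i < n ] (𝟙 (P? i) * 𝟙 (¬? (Q? i)) * t)
        ≡⟨ cong₂ _+_ (trans (∑-distrib-+ {n} _ _) (cong (ΣQF +_) (∑-distrib-+ {n} _ _)))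
             (sym (*-distribʳ-sum {n} t _)) ⟩
      ΣQF + (Σout + Σin) + r * t ∎

-- Runs of Shellsort

if-elim : {A B : Set} (P : B → Set) (A? : Dec A) {x y : B} →
          (A → P x) → (¬ A → P y) → P (if does A? then x else y)
if-elim P (yes a) f g = f a
if-elim P (no ¬a) f g = g ¬a

foldl-preserves : {A B : Set} (P : A → Set) {f : A → B → A} {xs : List B} →
                  All (λ x → ∀ s → P s → P (f s x)) xs → ∀ s → P s → P (List.foldl f s xs)
foldl-preserves P []           s p = p
foldl-preserves P (step ∷ all) s p = foldl-preserves P all _ (step s p)

All-take-tabulate : ∀ {m} {A : Set} {P : A → Set} s (f : Fin m → A) →
                    (∀ i → toℕ i < s → P (f i)) → All P (List.take s (List.tabulate f))
All-take-tabulate {zero}  zero    f Pf = []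
All-take-tabulate {zero}  (suc s) f Pf = []
All-take-tabulate {suc m} zero    f Pf = []
All-take-tabulate {suc m} (suc s) f Pf =
  Pf zero (s≤s z≤n) ∷ All-take-tabulate s (f ∘ suc) (λ i i<s → Pf (suc i) (s≤s i<s))

All-drop-tabulate : ∀ {m} {A : Set} {P : A → Set} s (f : Fin m → A) →
                    (∀ i → s ≤ toℕ i → P (f i)) → All P (List.drop s (List.tabulate f))
All-drop-tabulate         zero    f Pf = All.tabulate⁺ (λ i → Pf i z≤n)
All-drop-tabulate {zero}  (suc s) f Pf = []
All-drop-tabulate {suc m} (suc s) f Pf =
  All-drop-tabulate s (f ∘ suc) (λ i s≤i → Pf (suc i) (s≤s s≤i))

tabulate-last : ∀ {m} {A : Set} (f : Fin m → A) j → suc (toℕ j) ≡ m →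
                ∃[ xs ] List.tabulate f ≡ xs ∷ʳ f j
tabulate-last {suc zero}    f zero    _  = [] , refl
tabulate-last {suc (suc m)} f (suc j) eq
  with xs , tab ← tabulate-last (f ∘ suc) j (ℕ.suc-injective eq) = f zero ∷ xs , cong (f zero ∷_) tab

-- All that the cost estimates use of a pass: exchanged keys are h apart and out of order, and the
-- count grows by one.
Preserves : ∀ {n} → (State n → Set) → ℕ → Set
Preserves {n} P h = ∀ a c (i j : Fin n) → toℕ j ≡ toℕ i + h → toℕ (a j) < toℕ (a i) →
                    P (a , c) → P (exchange i j a , suc c)

module _ {n} (P : State n → Set) where

  sink-preserves : ∀ {h} → Preserves P h → ∀ r q .(bound : r + q * h < n) a c → P (a , c) →
                   P (map₂ (c +_) (sink h r q bound a))
  sink-preserves     step r zero    bound a c p = subst (λ c′ → P (a , c′)) (sym (ℕ.+-identityʳ c)) p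
  sink-preserves {h} step r (suc q) bound a c p = if-elim (P ∘ map₂ (c +_)) (a here Fin.<? a before)
    -- The recursive call counts from 0. This exchange is charged to c beforehand, so that the
    -- invariant always speaks of the running total.
    (λ a<a → subst (λ c′ → P (proj₁ rest , c′)) (sym (ℕ.+-suc c (proj₂ rest)))
      (sink-preserves step r q (earlier h r q bound) (exchange before here a) (suc c)
        (step a c before here distance a<a p)))
    (λ _ → subst (λ c′ → P (a , c′)) (sym (ℕ.+-identityʳ c)) p)
    where
    here before : Fin n
    here   = Fin.fromℕ< bound
    before = Fin.fromℕ< (earlier h r q bound)
    rest : State n
    rest = sink h r q (earlier h r q bound) (exchange before here a)
    shift : ∀ r x h → r + (h + x) ≡ r + x + h
    shift = solve-∀
    distance : toℕ here ≡ toℕ before + h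
    distance = trans (Fin.toℕ-fromℕ< bound)
      (trans (shift r (q * h) h) (cong (_+ h) (sym (Fin.toℕ-fromℕ< (earlier h r q bound)))))

  pass-preserves : ∀ {h} .{{_ : NonZero h}} → Preserves P h → ∀ st → P st → P (pass h st)
  pass-preserves {h} step = foldl-preserves P {f = sortChain h} (All.universal (λ r →
    foldl-preserves P {f = insertKey h} (All.universal (λ i st →
      sink-preserves step (toℕ i % h) (toℕ i / h)
        (subst (_< n) (m≡m%n+[m/n]*n (toℕ i) h) (Fin.toℕ<n i)) (proj₁ st) (proj₂ st)) (chain n h r)))
    (List.upTo h))

module _ {n p} (H : GapSequence p) (s : Fin p) (a : Array n) where

  open GapSequence H

  private
    step : State n → Fin p → State n
    step st j = pass (gap j) {{positive j}} st

  -- The passes up to here are exactly those whose gaps enter `β H n s`; the pass with `gap s`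
  -- itself is the first of the late ones.
  midway : State n
  midway = List.foldl step (a , 0) (List.take (toℕ s) (List.allFin p))

  private
    shellsort-midway : shellsort H a ≡ List.foldl step midway (List.drop (toℕ s) (List.allFin p))
    shellsort-midway = trans
      (cong (List.foldl step (a , 0)) (sym (List.take++drop≡id (toℕ s) (List.allFin p))))
      (List.foldl-++ step (a , 0) (List.take (toℕ s) (List.allFin p)) _)

  module _ (P : State n → Set) where

    before-midway : (∀ j → toℕ j < toℕ s → Preserves P (gap j)) → P (a , 0) → P midway
    before-midway pres = foldl-preserves P {f = step}
      (All-take-tabulate (toℕ s) (λ j → j) (λ j j<s → pass-preserves P {{positive j}} (pres j j<s)))
      (a , 0)

    after-midway : (∀ j → toℕ s ≤ toℕ j → Preserves P (gap j)) → P midway → P (shellsort H a)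
    after-midway pres = subst P (sym shellsort-midway) ∘ foldl-preserves P {f = step}
      (All-drop-tabulate (toℕ s) (λ j → j) (λ j s≤j → pass-preserves P {{positive j}} (pres j s≤j)))
      midway

    preserved : (∀ j → Preserves P (gap j)) → P (a , 0) → P (shellsort H a)
    preserved pres = after-midway (λ j _ → pres j) ∘ before-midway (λ j _ → pres j)

transpose-cases : ∀ {n} (i j k : Fin n) →
  (k ≡ i × transpose i j k ≡ j) ⊎ (k ≡ j × transpose i j k ≡ i) ⊎
  (k ≢ i × k ≢ j × transpose i j k ≡ k)
transpose-cases i j k with k Fin.≟ i
... | yes k≡i = inj₁ (k≡i , refl)
... | no  k≢i with k Fin.≟ j
...   | yes k≡j = inj₂ (inj₁ (k≡j , refl))
...   | no  k≢j = inj₂ (inj₂ (k≢i , k≢j , refl))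

Distinct : ∀ {n} → Array n → Set
Distinct a = ∀ i j → a i ≡ a j → i ≡ j

exchange-distinct : ∀ {n} h → Preserves {n} (Distinct ∘ proj₁) h
exchange-distinct h a c i j _ _ distinct x y eq = begin
  x                                   ≡⟨ transpose-inverse j i ⟨
  transpose j i (transpose i j x)     ≡⟨ cong (transpose j i) (distinct _ _ eq) ⟩
  transpose j i (transpose i j y)     ≡⟨ transpose-inverse j i ⟩
  y                                   ∎
  where open ≡-Reasoning

-- The last pass

Sorted< : ∀ {n} → ℕ → Array n → Set
Sorted< m a = ∀ i j → toℕ i < toℕ j → toℕ j < m → toℕ (a i) ≤ toℕ (a j)

-- Only the key at position q may be smaller than some keys before it.
Sorted<-except : ∀ {n} → ℕ → ℕ → Array n → Set
Sorted<-except q m a =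
  ∀ i j → toℕ i < toℕ j → toℕ j < m → toℕ j ≢ q → toℕ (a i) ≤ toℕ (a j)

-- The exemption travels with the sinking key. Position i is now exempt, the pair (i , j) has just
-- been put in order, and every other pair inherits an old inequality whose later position is not
-- `suc q`.
exchange-sorted : ∀ {n} q m (a : Array n) i j → toℕ i ≡ q → toℕ j ≡ suc q → toℕ (a j) < toℕ (a i) →
                  Sorted<-except (suc q) m a → Sorted<-except q m (exchange i j a)
exchange-sorted q m a i j refl j≡ aj<ai sorted x y x<y y<m y≢q
  with transpose-cases i j x | transpose-cases i j y
... | _ | inj₁ (refl , _) = contradiction refl y≢q
... | inj₁ (refl , τx) | inj₂ (inj₁ (refl , τy)) rewrite τx | τy = ℕ.<⇒≤ aj<ai
... | inj₂ (inj₁ (refl , τx)) | inj₂ (inj₁ (refl , τy)) = contradiction x<y (ℕ.<-irrefl refl)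
... | inj₂ (inj₂ (x≢i , x≢j , τx)) | inj₂ (inj₁ (refl , τy)) rewrite τx | τy =
  sorted x i (ℕ.≤∧≢⇒< (s≤s⁻¹ (subst (toℕ x <_) j≡ x<y)) (x≢i ∘ Fin.toℕ-injective))
    (ℕ.<-trans (ℕ.≤-reflexive (sym j≡)) y<m) (λ i≡ → ℕ.1+n≢n (sym i≡))
... | inj₁ (refl , τx) | inj₂ (inj₂ (y≢i , y≢j , τy)) rewrite τx | τy =
  sorted j y (ℕ.≤∧≢⇒< (subst (_≤ toℕ y) (sym j≡) x<y) (y≢j ∘ sym ∘ Fin.toℕ-injective))
    y<m (λ y≡ → y≢j (Fin.toℕ-injective (trans y≡ (sym j≡))))
... | inj₂ (inj₁ (refl , τx)) | inj₂ (inj₂ (y≢i , y≢j , τy)) rewrite τx | τy =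
  sorted i y (ℕ.<-trans (ℕ.≤-reflexive (sym j≡)) x<y) y<m
    (λ y≡ → y≢j (Fin.toℕ-injective (trans y≡ (sym j≡))))
... | inj₂ (inj₂ (_ , _ , τx)) | inj₂ (inj₂ (y≢i , y≢j , τy)) rewrite τx | τy =
  sorted x y x<y y<m (λ y≡ → y≢j (Fin.toℕ-injective (trans y≡ (sym j≡))))

-- Where the key stops, its predecessor is not larger and dominates everything before it; at
-- position 0 no pair is exempt. The offset r is a variable because it will be `toℕ i % 1`, which is
-- only propositionally 0.
sink-sorted : ∀ {n} m r q .(bound : r + q * 1 < n) (a : Array n) → r ≡ 0 →
              Sorted<-except q m a → Sorted< m (proj₁ (sink 1 r q bound a))
sink-sorted     m .0 zero    bound a refl sorted i j i<j j<m =
  sorted i j i<j j<m (ℕ.m<n⇒n≢0 i<j)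
sink-sorted {n} m .0 (suc q) bound a refl sorted =
  if-elim (Sorted< m ∘ proj₁) (a here Fin.<? a before)
    (λ a<a → sink-sorted m 0 q (earlier 1 0 q bound) (exchange before here a) refl
      (exchange-sorted q m a before here before≡ here≡ a<a sorted))
    (λ a≮a i j i<j j<m → stop (ℕ.≮⇒≥ a≮a) i j i<j j<m (toℕ j ≟ suc q))
  where
  here before : Fin n
  here   = Fin.fromℕ< bound
  before = Fin.fromℕ< (earlier 1 0 q bound)
  here≡ : toℕ here ≡ suc q
  here≡ = trans (Fin.toℕ-fromℕ< bound) (ℕ.*-identityʳ (suc q))
  before≡ : toℕ before ≡ q
  before≡ = trans (Fin.toℕ-fromℕ< (earlier 1 0 q bound)) (ℕ.*-identityʳ q)
  stop : toℕ (a before) ≤ toℕ (a here) → ∀ i j → toℕ i < toℕ j → toℕ j < m →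
         Dec (toℕ j ≡ suc q) → toℕ (a i) ≤ toℕ (a j)
  stop a≤a i j i<j j<m (no  j≢) = sorted i j i<j j<m j≢
  stop a≤a i j i<j j<m (yes j≡) with Fin.toℕ-injective {i = j} {here} (trans j≡ (sym here≡))
  ... | refl with toℕ i ≟ q
  ...   | yes i≡ with refl ← Fin.toℕ-injective {i = i} {before} (trans i≡ (sym before≡)) = a≤a
  ...   | no  i≢ = ℕ.≤-trans
    (sorted i before (subst (toℕ i <_) (sym before≡) i<q)
      (ℕ.<-trans (subst₂ _<_ (sym before≡) (sym here≡) ℕ.≤-refl) j<m)
      (λ eq → ℕ.1+n≢n (trans (sym eq) before≡)))
    a≤a
    where
    i<q : toℕ i < q
    i<q = ℕ.≤∧≢⇒< (s≤s⁻¹ (subst (toℕ i <_) here≡ i<j)) i≢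

insert-sorted : ∀ {n} (st : State n) i → Sorted< (toℕ i) (proj₁ st) →
                Sorted< (suc (toℕ i)) (proj₁ (insertKey 1 st i))
insert-sorted {n} (a , c) i sorted =
  sink-sorted (suc (toℕ i)) (toℕ i % 1) (toℕ i / 1)
    (subst (_< n) (m≡m%n+[m/n]*n (toℕ i) 1) (Fin.toℕ<n i)) a (n%1≡0 (toℕ i))
    (λ x y x<y y<m y≢ → sorted x y x<y
      (ℕ.≤∧≢⇒< (s≤s⁻¹ y<m) (λ eq → y≢ (trans eq (sym (n/1≡n (toℕ i)))))))

inserts-sorted : ∀ {n m} b (f : Fin m → Fin n) → (∀ i → toℕ (f i) ≡ b + toℕ i) → (st : State n) →
                 Sorted< b (proj₁ st) →
                 Sorted< (b + m) (proj₁ (List.foldl (insertKey 1) st (List.tabulate f)))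
inserts-sorted {m = zero}  b f f≡ st sorted =
  subst (λ k → Sorted< k (proj₁ st)) (sym (ℕ.+-identityʳ b)) sorted
inserts-sorted {m = suc m} b f f≡ st sorted =
  subst (λ k → Sorted< k (proj₁ (List.foldl (insertKey 1) st (List.tabulate f)))) (sym (ℕ.+-suc b m))
    (inserts-sorted (suc b) (f ∘ suc) (λ i → trans (f≡ (suc i)) (ℕ.+-suc b (toℕ i)))
      (insertKey 1 st (f zero))
      (subst (λ k → Sorted< (suc k) (proj₁ (insertKey 1 st (f zero)))) f0≡
        (insert-sorted st (f zero) (subst (λ k → Sorted< k (proj₁ st)) (sym f0≡) sorted))))
  where
  f0≡ : toℕ (f zero) ≡ b
  f0≡ = trans (f≡ zero) (ℕ.+-identityʳ b)

pass1-sorted : ∀ {n} (st : State n) → Sorted< n (proj₁ (pass 1 st))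
pass1-sorted {n} st =
  subst (λ is → Sorted< n (proj₁ (List.foldl (insertKey 1) st is))) (sym chain≡)
    (inserts-sorted 0 (λ i → i) (λ _ → refl) st (λ _ _ _ ()))
  where
  chain≡ : chain n 1 0 ≡ List.allFin n
  chain≡ = List.filter-all (λ i → toℕ i % 1 ≟ 0) (All.universal (λ i → n%1≡0 (toℕ i)) (List.allFin n))

module _ {n p} (H : GapSequence p) (a : Array n) where

  open GapSequence H

  shellsort-sorted : Sorted< n (proj₁ (shellsort H a))
  shellsort-sorted with last , last≡ , gap≡1 ← ends-in-1
                   with js , all≡ ← tabulate-last (λ j → j) last last≡ =
    subst (Sorted< n ∘ proj₁)
      (sym (trans (cong (List.foldl step (a , 0)) all≡) (List.foldl-∷ʳ step (a , 0) last js)))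
      (pass-sorted (gap last) {{positive last}} gap≡1 (List.foldl step (a , 0) js))
    where
    step : State n → Fin p → State n
    step st j = pass (gap j) {{positive j}} st
    pass-sorted : ∀ h .{{_ : NonZero h}} → h ≡ 1 → ∀ st → Sorted< n (proj₁ (pass h st))
    pass-sorted .1 refl = pass1-sorted

  shellsort-distinct : Distinct a → Distinct (proj₁ (shellsort H a))
  shellsort-distinct = preserved H (proj₁ ends-in-1) a (Distinct ∘ proj₁) (λ j → exchange-distinct (gap j))

  -- Sorted and distinct means strictly increasing, so induction on the position applies. In the
  -- late cost this confines the small keys of the final array to the initial segment.
  key≥position : Distinct a → ∀ i → toℕ i ≤ toℕ (proj₁ (shellsort H a) i)
  key≥position distinct i = bound (toℕ i) i refl
    where
    b : Array n
    b = proj₁ (shellsort H a)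
    bound : ∀ k i → toℕ i ≡ k → k ≤ toℕ (b i)
    bound zero    i _  = z≤n
    bound (suc k) i i≡ = ℕ.≤-<-trans (bound k i′ i′≡)
      (ℕ.≤∧≢⇒< (shellsort-sorted i′ i i′<i (Fin.toℕ<n i))
        (λ eq → ℕ.<⇒≢ i′<i (cong toℕ (shellsort-distinct distinct i′ i (Fin.toℕ-injective eq)))))
      where
      k<n : k < n
      k<n = ℕ.<-trans (ℕ.≤-reflexive (sym i≡)) (Fin.toℕ<n i)
      i′ : Fin n
      i′ = Fin.fromℕ< k<n
      i′≡ : toℕ i′ ≡ k
      i′≡ = Fin.toℕ-fromℕ< k<n
      i′<i : toℕ i′ < toℕ i
      i′<i = subst₂ _<_ (sym i′≡) (sym i≡) ℕ.≤-refl

-- The cost of moving small keys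

-- Injectivity allows at most α values below α and at most `n ∸ α` values from α on. The two counts
-- add up to n, so both bounds are attained.
count-below : ∀ {n} {f : Fin n → ℕ} → Injective _≡_ _≡_ f → (∀ i → f i < n) → ∀ {α} → α ≤ n →
              ∑[ i < n ] 𝟙 (f i <? α) ≡ α
count-below {n} {f} inj f<n {α} α≤n = ℕ.≤-antisym
  (count-injective-≤ inj (λ i → f i <? α) 0 α (λ i fi<α → z≤n , fi<α))
  (ℕ.+-cancelʳ-≤ (n ∸ α) α (∑[ i < n ] 𝟙 (f i <? α)) (begin
    α + (n ∸ α)
      ≡⟨ ℕ.m+[n∸m]≡n α≤n ⟩
    n
      ≡⟨ trans (sum-const n 1) (ℕ.*-identityʳ n) ⟨
    ∑[ i < n ] 1
      ≡⟨ sum-cong-≗ {n} (λ i → 𝟙+𝟙¬ (f i <? α)) ⟨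
    ∑[ i < n ] (𝟙 (f i <? α) + 𝟙 (¬? (f i <? α)))
      ≡⟨ ∑-distrib-+ {n} (λ i → 𝟙 (f i <? α)) (λ i → 𝟙 (¬? (f i <? α))) ⟩
    ∑[ i < n ] 𝟙 (f i <? α) + ∑[ i < n ] 𝟙 (¬? (f i <? α))
      ≤⟨ ℕ.+-monoʳ-≤ (∑[ i < n ] 𝟙 (f i <? α))
           (count-injective-≤ inj (λ i → ¬? (f i <? α)) α (n ∸ α)
             (λ i fi≮α → ℕ.≮⇒≥ fi≮α , subst (f i <_) (sym (ℕ.m+[n∸m]≡n α≤n)) (f<n i))) ⟩
    ∑[ i < n ] 𝟙 (f i <? α) + (n ∸ α) ∎))
  where open ℕ.≤-Reasoning

low? : ∀ {n} α (a : Array n) i → Dec (toℕ (a i) < α)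
low? α a i = toℕ (a i) <? α

lowSum : ∀ {n} → ℕ → (Fin n → ℕ) → Array n → ℕ
lowSum {n} α F a = ∑[ i < n ] (𝟙 (low? α a i) * F i)

count-low : ∀ {n α} (a : Array n) → Distinct a → α ≤ n → ∑[ i < n ] 𝟙 (low? α a i) ≡ α
count-low a distinct =
  count-below (λ eq → distinct _ _ (Fin.toℕ-injective eq)) (λ i → Fin.toℕ<n (a i))

Near : ∀ {n} → ℕ → (Fin n → ℕ) → ℕ → Set
Near C F h = ∀ i j → toℕ j ≡ toℕ i + h → F i ≤ F j + C × F j ≤ F i + C

-- The smaller key of the pair is at j. If the key at i is small, then both are, and the set of
-- small positions stays the same. Otherwise at most the key at j is small, and its move to i
-- changes the sum by at most C.
lowSum-exchange : ∀ {n} α (F : Fin n → ℕ) (a : Array n) C i j →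
                  F i ≤ F j + C → F j ≤ F i + C → toℕ (a j) < toℕ (a i) →
                  lowSum α F (exchange i j a) ≤ lowSum α F a + C ×
                  lowSum α F a ≤ lowSum α F (exchange i j a) + C
lowSum-exchange {n} α F a C i j Fi≤ Fj≤ aj<ai = by-cases (toℕ (a i) <? α)
  where
  F′ : Fin n → ℕ
  F′ = F ∘ transpose j i

  -- Reindexing shifts the exchange from the array to the weights, so that both sums run over the
  -- small positions of the same array.
  moved : lowSum α F (exchange i j a) ≡ lowSum α F′ a
  moved = trans
    (sum-permute (λ k → 𝟙 (low? α (exchange i j a) k) * F k) (Perm.transpose j i))
    (sum-cong-≗ {n} (λ k → cong (λ x → 𝟙 (low? α a x) * F′ k) (transpose-inverse i j)))

  -- The key at i is not small, so only the key at j contributes.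
  near : ∀ G G′ → G j ≤ G′ j + C → (∀ k → k ≢ i → k ≢ j → G k ≡ G′ k) → ¬ toℕ (a i) < α →
         lowSum α G a ≤ lowSum α G′ a + C
  near G G′ Gj≤ same ai≮α = begin
    lowSum α G a
      ≤⟨ sum-mono-≤ {n} pointwise ⟩
    ∑[ k < n ] (𝟙 (low? α a k) * G′ k + 𝟙 (toℕ k ≟ toℕ j) * C)
      ≡⟨ ∑-distrib-+ {n} (λ k → 𝟙 (low? α a k) * G′ k) (λ k → 𝟙 (toℕ k ≟ toℕ j) * C) ⟩
    lowSum α G′ a + ∑[ k < n ] (𝟙 (toℕ k ≟ toℕ j) * C)
      ≡⟨ cong (lowSum α G′ a +_) (*-distribʳ-sum {n} C (λ k → 𝟙 (toℕ k ≟ toℕ j))) ⟨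
    lowSum α G′ a + ∑[ k < n ] 𝟙 (toℕ k ≟ toℕ j) * C
      ≤⟨ ℕ.+-monoʳ-≤ (lowSum α G′ a) (ℕ.*-monoˡ-≤ C (sum-𝟙≟≤1 {n} {toℕ} Fin.toℕ-injective (toℕ j))) ⟩
    lowSum α G′ a + 1 * C
      ≡⟨ cong (lowSum α G′ a +_) (ℕ.*-identityˡ C) ⟩
    lowSum α G′ a + C ∎
    where
    open ℕ.≤-Reasoning
    pointwise : ∀ k → 𝟙 (low? α a k) * G k ≤ 𝟙 (low? α a k) * G′ k + 𝟙 (toℕ k ≟ toℕ j) * C
    pointwise k with k Fin.≟ i | k Fin.≟ j
    ... | yes refl | _ = subst (λ x → x * G k ≤ 𝟙 (low? α a k) * G′ k + 𝟙 (toℕ k ≟ toℕ j) * C)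
      (sym (𝟙-false (low? α a k) ai≮α)) z≤n
    ... | no k≢i | no k≢j = ℕ.≤-trans
      (ℕ.≤-reflexive (cong (𝟙 (low? α a k) *_) (same k k≢i k≢j))) (ℕ.m≤m+n _ _)
    ... | no _ | yes refl = subst (λ x → 𝟙 (low? α a k) * G k ≤ 𝟙 (low? α a k) * G′ k + x * C)
      (sym (𝟙-true (toℕ k ≟ toℕ k) refl)) (weigh (𝟙 (low? α a k)) (𝟙≤1 (low? α a k)))
      where
      weigh : ∀ w → w ≤ 1 → w * G k ≤ w * G′ k + 1 * C
      weigh zero       _         = z≤n
      weigh (suc zero) _         =
        subst₂ _≤_ (sym (ℕ.*-identityˡ (G k))) (sym (cong₂ _+_ (ℕ.*-identityˡ (G′ k)) (ℕ.*-identityˡ C))) Gj≤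
      weigh (suc (suc _)) (s≤s ())

  F′j≡ : F′ j ≡ F i
  F′j≡ with transpose-cases j i j
  ... | inj₁ (_ , eq)              = cong F eq
  ... | inj₂ (inj₁ (refl , eq))    = cong F eq
  ... | inj₂ (inj₂ (j≢j , _ , _))  = contradiction refl j≢j

  F′k≡ : ∀ k → k ≢ i → k ≢ j → F′ k ≡ F k
  F′k≡ k k≢i k≢j with transpose-cases j i k
  ... | inj₁ (k≡j , _)            = contradiction k≡j k≢j
  ... | inj₂ (inj₁ (k≡i , _))     = contradiction k≡i k≢i
  ... | inj₂ (inj₂ (_ , _ , eq))  = cong F eq

  both-low : toℕ (a i) < α → lowSum α F (exchange i j a) ≡ lowSum α F a
  both-low ai<α = sum-cong-≗ {n} (λ k → cong (_* F k) (same k))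
    where
    same : ∀ k → 𝟙 (low? α (exchange i j a) k) ≡ 𝟙 (low? α a k)
    same k with transpose-cases i j k
    ... | inj₁ (refl , eq) = trans (cong (𝟙 ∘ low? α a) eq)
      (𝟙-cong (low? α a j) (low? α a i) (λ _ → ai<α) (ℕ.<-trans aj<ai))
    ... | inj₂ (inj₁ (refl , eq)) = trans (cong (𝟙 ∘ low? α a) eq)
      (𝟙-cong (low? α a i) (low? α a j) (ℕ.<-trans aj<ai) (λ _ → ai<α))
    ... | inj₂ (inj₂ (_ , _ , eq)) = cong (𝟙 ∘ low? α a) eq

  by-cases : Dec (toℕ (a i) < α) → _
  by-cases (yes ai<α) =
    ℕ.≤-trans (ℕ.≤-reflexive (both-low ai<α)) (ℕ.m≤m+n _ C) ,
    ℕ.≤-trans (ℕ.≤-reflexive (sym (both-low ai<α))) (ℕ.m≤m+n _ C)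
  by-cases (no ai≮α) =
    subst (_≤ lowSum α F a + C) (sym moved)
      (near F′ F (subst (_≤ F j + C) (sym F′j≡) Fi≤) F′k≡ ai≮α) ,
    subst (λ x → lowSum α F a ≤ x + C) (sym moved)
      (near F F′ (subst (λ x → F j ≤ x + C) (sym F′j≡) Fj≤) (λ k k≢i k≢j → sym (F′k≡ k k≢i k≢j)) ai≮α)

-- |lowSum α F b − lowSum α F a| ≤ C (d − c), stated without subtraction.
DriftBounded : ∀ {n} → ℕ → (Fin n → ℕ) → ℕ → State n → State n → Set
DriftBounded α F C (a , c) (b , d) =
  lowSum α F b + C * c ≤ lowSum α F a + C * d × lowSum α F a + C * c ≤ lowSum α F b + C * d

drift-refl : ∀ {n} α (F : Fin n → ℕ) C st → DriftBounded α F C st st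
drift-refl α F C st = ℕ.≤-refl , ℕ.≤-refl

drift-preserves : ∀ {n} α (F : Fin n → ℕ) C st {h} → Near C F h → Preserves (DriftBounded α F C st) h
drift-preserves α F C (a , c) near b d i j dist bj<bi (up , down)
  with moved≤ , ≤moved ← lowSum-exchange α F b C i j (proj₁ (near i j dist)) (proj₂ (near i j dist)) bj<bi =
  (begin
    lowSum α F (exchange i j b) + C * c  ≤⟨ ℕ.+-monoˡ-≤ (C * c) moved≤ ⟩
    lowSum α F b + C + C * c             ≡⟨ swap (lowSum α F b) C (C * c) ⟩
    lowSum α F b + C * c + C             ≤⟨ ℕ.+-monoˡ-≤ C up ⟩
    lowSum α F a + C * d + C             ≡⟨ count (lowSum α F a) C d ⟩
    lowSum α F a + C * suc d             ∎) ,
  (begin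
    lowSum α F a + C * c                           ≤⟨ down ⟩
    lowSum α F b + C * d                           ≤⟨ ℕ.+-monoˡ-≤ (C * d) ≤moved ⟩
    lowSum α F (exchange i j b) + C + C * d        ≡⟨ swap (lowSum α F (exchange i j b)) C (C * d) ⟩
    lowSum α F (exchange i j b) + C * d + C        ≡⟨ count (lowSum α F (exchange i j b)) C d ⟩
    lowSum α F (exchange i j b) + C * suc d        ∎)
  where
  open ℕ.≤-Reasoning
  swap : ∀ x y z → x + y + z ≡ x + z + y
  swap = solve-∀
  count : ∀ x y z → x + y * z + y ≡ x + y * suc z
  count = solve-∀

∖-triangle : ∀ {n} {P Q R : Fin n → Set} (P? : ∀ i → Dec (P i)) (Q? : ∀ i → Dec (Q i)) (R? : ∀ i → Dec (R i)) →
             ∣ P? ∖ R? ∣ ≤ ∣ P? ∖ Q? ∣ + ∣ Q? ∖ R? ∣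
∖-triangle {n} P? Q? R? = ℕ.≤-trans
  (sum-mono-≤ {n} (λ i → pointwise (P? i) (Q? i) (R? i)))
  (ℕ.≤-reflexive (∑-distrib-+ {n} (λ i → 𝟙 (P? i) * 𝟙 (¬? (Q? i))) (λ i → 𝟙 (Q? i) * 𝟙 (¬? (R? i)))))
  where
  pointwise : {A B C : Set} (A? : Dec A) (B? : Dec B) (C? : Dec C) →
              𝟙 A? * 𝟙 (¬? C?) ≤ 𝟙 A? * 𝟙 (¬? B?) + 𝟙 B? * 𝟙 (¬? C?)
  pointwise (no  _) _       _       = z≤n
  pointwise (yes _) (yes _) _       = ℕ.≤-refl
  pointwise (yes _) (no  _) (yes _) = z≤n
  pointwise (yes _) (no  _) (no  _) = ℕ.≤-refl

-- Cauchy-Schwarz in the natural numbers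

square-cancel-≤ : ∀ {m n} → m * m ≤ n * n → m ≤ n
square-cancel-≤ m²≤n² = ℕ.≮⇒≥ (λ n<m → ℕ.<⇒≱ (ℕ.*-mono-< n<m n<m) m²≤n²)

4mn≤[m+n]² : ∀ m n → 4 * (m * n) ≤ (m + n) * (m + n)
4mn≤[m+n]² m n with ℕ.≤-total m n
... | inj₁ m≤n with k , refl ← ℕ.m≤n⇒∃[o]m+o≡n m≤n =
  subst (4 * (m * (m + k)) ≤_) (expand m k) (ℕ.m≤m+n _ (k * k))
  where
  expand : ∀ m k → 4 * (m * (m + k)) + k * k ≡ (m + (m + k)) * (m + (m + k))
  expand = solve-∀
... | inj₂ n≤m with k , refl ← ℕ.m≤n⇒∃[o]m+o≡n n≤m =
  subst (4 * ((n + k) * n) ≤_) (expand n k) (ℕ.m≤m+n _ (k * k))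
  where
  expand : ∀ n k → 4 * ((n + k) * n) + k * k ≡ ((n + k) + n) * ((n + k) + n)
  expand = solve-∀

-- Read p ≤ √(ux) and q ≤ √(vy). Squaring the cross term 2pq reduces it to the AM-GM inequality for
-- uy and vx, so no roots are taken.
cauchy-schwarz : ∀ {p q u v x y} → p * p ≤ u * x → q * q ≤ v * y →
                 (p + q) * (p + q) ≤ (u + v) * (x + y)
cauchy-schwarz {p} {q} {u} {v} {x} {y} p²≤ q²≤ = begin
  (p + q) * (p + q)                  ≡⟨ expand p q ⟩
  p * p + q * q + 2 * (p * q)        ≤⟨ ℕ.+-mono-≤ (ℕ.+-mono-≤ p²≤ q²≤) 2pq≤ ⟩
  u * x + v * y + (u * y + v * x)    ≡⟨ collect u v x y ⟩
  (u + v) * (x + y)                  ∎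
  where
  open ℕ.≤-Reasoning
  expand : ∀ p q → (p + q) * (p + q) ≡ p * p + q * q + 2 * (p * q)
  expand = solve-∀
  collect : ∀ u v x y → u * x + v * y + (u * y + v * x) ≡ (u + v) * (x + y)
  collect = solve-∀
  square : ∀ p q → 2 * (p * q) * (2 * (p * q)) ≡ 4 * (p * p * (q * q))
  square = solve-∀
  regroup : ∀ u v x y → 4 * (u * x * (v * y)) ≡ 4 * (u * y * (v * x))
  regroup = solve-∀
  2pq≤ : 2 * (p * q) ≤ u * y + v * x
  2pq≤ = square-cancel-≤ (begin
    2 * (p * q) * (2 * (p * q))            ≡⟨ square p q ⟩
    4 * (p * p * (q * q))                  ≤⟨ ℕ.*-monoʳ-≤ 4 (ℕ.*-mono-≤ p²≤ q²≤) ⟩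
    4 * (u * x * (v * y))                  ≡⟨ regroup u v x y ⟩
    4 * (u * y * (v * x))                  ≤⟨ 4mn≤[m+n]² (u * y) (v * x) ⟩
    (u * y + v * x) * (u * y + v * x)      ∎)

gap-antitone : ∀ {p} (H : GapSequence p) {i j} → toℕ i ≤ toℕ j →
               GapSequence.gap H j ≤ GapSequence.gap H i
gap-antitone H {i} {j} i≤j with ℕ.m≤n⇒m<n∨m≡n i≤j
... | inj₁ i<j = ℕ.<⇒≤ (GapSequence.decreasing H i<j)
... | inj₂ i≡j = ℕ.≤-reflexive (cong (GapSequence.gap H) (Fin.toℕ-injective (sym i≡j)))

-- Costs of the early and of the late passes

module _ {n p} (H : GapSequence p) (s : Fin p)
  (a : Array n) (distinct : Distinct a) {α : ℕ} (α≤n : α ≤ n) where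

  open GapSequence H

  private
    mid : Array n
    mid = proj₁ (midway H s a)
    E₁ E : ℕ
    E₁ = proj₂ (midway H s a)
    E  = exchanges H a

    initial? : ∀ (i : Fin n) → Dec (toℕ i < α)
    initial? i = toℕ i <? α

    mid-count : ∑[ i < n ] 𝟙 (low? α mid i) ≡ α
    mid-count = count-low mid
      (before-midway H s a (Distinct ∘ proj₁) (λ j _ → exchange-distinct (gap j)) distinct) α≤n

  -- The weights 2i + 1 lie symmetrically about the level 2α with one position per depth on each
  -- side, so `rearrangement` applies with μ = 1. An exchange lowers the sum by at most `2 * gap s`,
  -- and the final sum is at most that of the initial segment. E₁ stands on the left to avoid a
  -- truncated difference.
  late-cost : ∣ low? α mid ∖ initial? ∣ * ∣ low? α mid ∖ initial? ∣ + gap s * E₁ ≤ gap s * E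
  late-cost = ℕ.*-cancelˡ-≤ 2 (ℕ.+-cancelʳ-≤ ΣI _ _ (begin
    2 * (q * q + gap s * E₁) + ΣI
      ≡⟨ regroup (q * q) (gap s) E₁ ΣI ⟩
    2 * (q * q) + 1 * ΣI + 2 * gap s * E₁
      ≤⟨ ℕ.+-monoˡ-≤ (2 * gap s * E₁) (rearrangement (low? α mid) initial?
           (trans mid-count (sym initial-count)) F y (2 * α) 1 inside outside sparse-in sparse-out) ⟩
    1 * lowSum α F mid + 2 * gap s * E₁
      ≡⟨ cong (_+ 2 * gap s * E₁) (ℕ.*-identityˡ (lowSum α F mid)) ⟩
    lowSum α F mid + 2 * gap s * E₁
      ≤⟨ proj₂ (after-midway H s a (DriftBounded α F (2 * gap s) (midway H s a))
           (λ j s≤j → drift-preserves α F (2 * gap s) (midway H s a) (near j s≤j))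
           (drift-refl α F (2 * gap s) (midway H s a))) ⟩
    lowSum α F (proj₁ (shellsort H a)) + 2 * gap s * E
      ≤⟨ ℕ.+-monoˡ-≤ (2 * gap s * E) (sum-mono-≤ {n} (λ i → ℕ.*-monoˡ-≤ (F i)
           (𝟙-mono (low? α (proj₁ (shellsort H a)) i) (initial? i)
             (ℕ.≤-<-trans (key≥position H a distinct i))))) ⟩
    ΣI + 2 * gap s * E
      ≡⟨ trans (ℕ.+-comm ΣI _) (cong (_+ ΣI) (ℕ.*-assoc 2 (gap s) E)) ⟩
    2 * (gap s * E) + ΣI ∎))
    where
    open ℕ.≤-Reasoning
    F y : Fin n → ℕ
    F i = suc (2 * toℕ i)
    -- At most one of the two truncated differences is non-zero: this is the number of positions
    -- between i and the boundary at α.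
    y i = (α ∸ suc (toℕ i)) + (toℕ i ∸ α)

    q ΣI : ℕ
    q  = ∣ low? α mid ∖ initial? ∣
    ΣI = ∑[ i < n ] (𝟙 (initial? i) * F i)

    regroup : ∀ x h e z → 2 * (x + h * e) + z ≡ 2 * x + 1 * z + 2 * h * e
    regroup = solve-∀

    initial-count : ∑[ i < n ] 𝟙 (initial? i) ≡ α
    initial-count = count-below Fin.toℕ-injective Fin.toℕ<n α≤n

    inside : ∀ i → toℕ i < α → F i + suc (2 * y i) ≡ 2 * α
    inside i i<α = trans
      (cong (λ z → F i + suc (2 * ((α ∸ suc (toℕ i)) + z))) (ℕ.m≤n⇒m∸n≡0 (ℕ.<⇒≤ i<α)))
      (trans (double (toℕ i) (α ∸ suc (toℕ i))) (cong (2 *_) (ℕ.m+[n∸m]≡n i<α)))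
      where
      double : ∀ i z → suc (2 * i) + suc (2 * (z + 0)) ≡ 2 * (suc i + z)
      double = solve-∀

    outside : ∀ i → ¬ toℕ i < α → F i ≡ 2 * α + suc (2 * y i)
    outside i i≮α = trans
      (trans (cong (λ z → suc (2 * z)) (sym (ℕ.m+[n∸m]≡n α≤i))) (double α (toℕ i ∸ α)))
      (cong (λ z → 2 * α + suc (2 * (z + (toℕ i ∸ α)))) (sym (ℕ.m≤n⇒m∸n≡0 (ℕ.m≤n⇒m≤1+n α≤i))))
      where
      α≤i : α ≤ toℕ i
      α≤i = ℕ.≮⇒≥ i≮α
      double : ∀ α z → suc (2 * (α + z)) ≡ 2 * α + suc (2 * (0 + z))
      double = solve-∀

    sparse-in : ∀ l → ∑[ i < n ] (𝟙 (initial? i) * 𝟙 (y i <? l)) ≤ 1 * l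
    sparse-in l = subst (∑[ i < n ] (𝟙 (initial? i) * 𝟙 (y i <? l)) ≤_) (sym (ℕ.*-identityˡ l))
      (ℕ.≤-trans (sum-mono-≤ {n} (λ i → ℕ.≤-reflexive (𝟙-× (initial? i) (y i <? l))))
        (count-injective-≤ Fin.toℕ-injective (λ i → initial? i ×-dec (y i <? l)) (α ∸ l) l
          (λ i (i<α , yi<l) →
            let α≤i+l = ℕ.≤-trans (ℕ.≤-reflexive (sym (ℕ.m+[n∸m]≡n i<α)))
                          (ℕ.≤-trans (ℕ.≤-reflexive (sym (ℕ.+-suc (toℕ i) _)))
                            (ℕ.+-monoʳ-≤ (toℕ i) (ℕ.≤-trans (s≤s (ℕ.m≤m+n _ _)) yi<l)))
            in ℕ.m≤n+o⇒m∸n≤o α l (subst (α ≤_) (ℕ.+-comm (toℕ i) l) α≤i+l) ,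
               ℕ.<-≤-trans i<α (ℕ.≤-trans (ℕ.m≤n+m∸n α l) (ℕ.≤-reflexive (ℕ.+-comm l _))))))

    sparse-out : ∀ l → ∑[ i < n ] (𝟙 (¬? (initial? i)) * 𝟙 (y i <? l)) ≤ 1 * l
    sparse-out l = subst (∑[ i < n ] (𝟙 (¬? (initial? i)) * 𝟙 (y i <? l)) ≤_) (sym (ℕ.*-identityˡ l))
      (ℕ.≤-trans (sum-mono-≤ {n} (λ i → ℕ.≤-reflexive (𝟙-× (¬? (initial? i)) (y i <? l))))
        (count-injective-≤ Fin.toℕ-injective (λ i → ¬? (initial? i) ×-dec (y i <? l)) α l
          (λ i (i≮α , yi<l) → ℕ.≮⇒≥ i≮α ,
            subst (_< α + l) (ℕ.m+[n∸m]≡n (ℕ.≮⇒≥ i≮α))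
              (ℕ.+-monoʳ-< α (ℕ.≤-<-trans (ℕ.m≤n+m (toℕ i ∸ α) _) yi<l)))))

    near : ∀ j → toℕ s ≤ toℕ j → Near (2 * gap s) F (gap j)
    near j s≤j x z z≡ rewrite z≡ =
      ℕ.≤-trans (s≤s (ℕ.*-monoʳ-≤ 2 (ℕ.m≤m+n (toℕ x) (gap j)))) (ℕ.m≤m+n _ (2 * gap s)) ,
      s≤s (ℕ.≤-trans (ℕ.≤-reflexive (ℕ.*-distribˡ-+ 2 (toℕ x) (gap j)))
        (ℕ.+-monoʳ-≤ (2 * toℕ x) (ℕ.*-monoʳ-≤ 2 (gap-antitone H s≤j))))

  module _ (F y : Fin n → ℕ) {t μ C u : ℕ} (scale : μ * C ≡ 2 * u)
    (near : ∀ j → toℕ j < toℕ s → Near C F (gap j))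
    (inside  : ∀ i →   toℕ (a i) < α → F i + suc (2 * y i) ≡ t)
    (outside : ∀ i → ¬ toℕ (a i) < α → F i ≡ t + suc (2 * y i))
    (sparse-in  : ∀ l → ∑[ i < n ] (𝟙 (low? α a i) * 𝟙 (y i <? l)) ≤ μ * l)
    (sparse-out : ∀ l → ∑[ i < n ] (𝟙 (¬? (low? α a i)) * 𝟙 (y i <? l)) ≤ μ * l) where

    -- At the start the small keys fill the sublevel set exactly, so their sum begins at its minimum
    -- and climbs by at most C per exchange; `scale` rewrites the resulting 2r² ≤ μ C E₁.
    early-cost : ∣ low? α mid ∖ low? α a ∣ * ∣ low? α mid ∖ low? α a ∣ ≤ u * E₁
    early-cost = ℕ.*-cancelˡ-≤ 2 (ℕ.+-cancelʳ-≤ (μ * lowSum α F a) _ _ (begin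
      2 * (r * r) + μ * lowSum α F a
        ≤⟨ rearrangement (low? α mid) (low? α a) (trans mid-count (sym (count-low a distinct α≤n)))
             F y t μ inside outside sparse-in sparse-out ⟩
      μ * lowSum α F mid
        ≤⟨ ℕ.*-monoʳ-≤ μ (ℕ.≤-trans (ℕ.m≤m+n _ (C * 0)) (proj₁ drift)) ⟩
      μ * (lowSum α F a + C * E₁)
        ≡⟨ regroup μ (lowSum α F a) C E₁ ⟩
      μ * C * E₁ + μ * lowSum α F a
        ≡⟨ cong (_+ μ * lowSum α F a) (trans (cong (_* E₁) scale) (ℕ.*-assoc 2 u E₁)) ⟩
      2 * (u * E₁) + μ * lowSum α F a ∎))
      where
      open ℕ.≤-Reasoning
      r : ℕ
      r = ∣ low? α mid ∖ low? α a ∣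
      regroup : ∀ m x c e → m * (x + c * e) ≡ m * c * e + m * x
      regroup = solve-∀
      drift : DriftBounded α F C (a , 0) (midway H s a)
      drift = before-midway H s a (DriftBounded α F C (a , 0))
        (λ j j<s → drift-preserves α F C (a , 0) (near j j<s)) (drift-refl α F C (a , 0))

    displaced²≤cost : ∣ low? α a ∖ initial? ∣ * ∣ low? α a ∖ initial? ∣ ≤ (u + gap s) * E
    displaced²≤cost = begin
      m * m
        ≤⟨ ℕ.*-mono-≤ m≤r+q m≤r+q ⟩
      (r + q) * (r + q)
        ≤⟨ cauchy-schwarz {r} {q} {u} {gap s} early-cost q²≤ ⟩
      (u + gap s) * (E₁ + (E ∸ E₁))
        ≡⟨ cong ((u + gap s) *_) (ℕ.m+[n∸m]≡n E₁≤E) ⟩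
      (u + gap s) * E ∎
      where
      open ℕ.≤-Reasoning
      m r q : ℕ
      m = ∣ low? α a ∖ initial? ∣
      r = ∣ low? α mid ∖ low? α a ∣
      q = ∣ low? α mid ∖ initial? ∣
      m≤r+q : m ≤ r + q
      -- A starting place beyond α is either vacated by the middle of the run or still holds a small
      -- key there. Vacated places are as many as newly occupied ones, which is what `early-cost`
      -- counts.
      m≤r+q = subst (λ x → m ≤ x + q)
        (∣∖∣-sym (low? α a) (low? α mid) (trans (count-low a distinct α≤n) (sym mid-count)))
        (∖-triangle (low? α a) (low? α mid) initial?)
      E₁≤E : E₁ ≤ E
      -- That exchanges only accumulate is read off from `late-cost`, as `gap s` is positive.
      E₁≤E = ℕ.*-cancelˡ-≤ (gap s) {{positive s}} (ℕ.≤-trans (ℕ.m≤n+m _ (q * q)) late-cost)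
      q²≤ : q * q ≤ gap s * (E ∸ E₁)
      q²≤ = ℕ.+-cancelʳ-≤ (gap s * E₁) _ _ (ℕ.≤-trans late-cost (ℕ.≤-reflexive
        (trans (cong (gap s *_) (sym (ℕ.m∸n+n≡m E₁≤E))) (ℕ.*-distribˡ-+ (gap s) (E ∸ E₁) E₁))))

-- Circular distances

-- If n < m the truncated difference is 0; injectivity proofs therefore use this in both orders.
%-≡⇒∣∸ : ∀ m n d .{{_ : NonZero d}} → m % d ≡ n % d → d ∣ n ∸ m
%-≡⇒∣∸ m n d eq = divides (n / d ∸ m / d) (begin
  n ∸ m                                            ≡⟨ cong₂ _∸_ (m≡m%n+[m/n]*n n d) (m≡m%n+[m/n]*n m d) ⟩
  n % d + n / d * d ∸ (m % d + m / d * d)          ≡⟨ cong (λ r → n % d + n / d * d ∸ (r + m / d * d)) eq ⟩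
  n % d + n / d * d ∸ (n % d + m / d * d)          ≡⟨ ℕ.[m+n]∸[m+o]≡n∸o (n % d) _ _ ⟩
  n / d * d ∸ m / d * d                            ≡⟨ ℕ.*-distribʳ-∸ d (n / d) (m / d) ⟨
  (n / d ∸ m / d) * d                              ∎)
  where open ≡-Reasoning

∣∧<⇒≡0 : ∀ {d m} → d ∣ m → m < d → m ≡ 0
∣∧<⇒≡0 {m = zero}  _   _   = refl
∣∧<⇒≡0 {m = suc m} d∣m m<d = contradiction (∣⇒≤ d∣m) (ℕ.<⇒≱ m<d)

suc-% : ∀ m d .{{_ : NonZero d}} →
        (suc (m % d) < d × suc m % d ≡ suc (m % d)) ⊎ (suc (m % d) ≡ d × suc m % d ≡ 0)
suc-% m d with ℕ.m≤n⇒m<n∨m≡n (m%n<n m d)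
                | trans (cong (λ x → suc x % d) (m≡m%n+[m/n]*n m d)) ([m+kn]%n≡m%n (suc (m % d)) (m / d) d)
... | inj₁ <d | reduce = inj₁ (<d , trans reduce (m<n⇒m%n≡m <d))
... | inj₂ ≡d | reduce = inj₂ (≡d , trans reduce (trans (cong (_% d) ≡d) (n%n≡0 d)))

Within : ℕ → ℕ → ℕ → Set
Within c m n = m ≤ n + c × n ≤ m + c

Within-sym : ∀ {c m n} → Within c m n → Within c n m
Within-sym (m≤ , n≤) = n≤ , m≤

Within-trans : ∀ {b c l m n} → Within b l m → Within c m n → Within (b + c) l n
Within-trans {b} {c} {l} {m} {n} (l≤ , m≤) (m≤′ , n≤) =
  ℕ.≤-trans l≤ (ℕ.≤-trans (ℕ.+-monoˡ-≤ b m≤′) (ℕ.≤-reflexive (swap n c b))) ,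
  ℕ.≤-trans n≤ (ℕ.≤-trans (ℕ.+-monoˡ-≤ c m≤) (ℕ.≤-reflexive (ℕ.+-assoc l b c)))
  where
  swap : ∀ x y z → x + y + z ≡ x + (z + y)
  swap = solve-∀

Within-weaken : ∀ {b c m n} → b ≤ c → Within b m n → Within c m n
Within-weaken b≤c (m≤ , n≤) = ℕ.≤-trans m≤ (ℕ.+-monoʳ-≤ _ b≤c) , ℕ.≤-trans n≤ (ℕ.+-monoʳ-≤ _ b≤c)

⊓∸-lipschitz : ∀ m z → Within 1 (m ⊓ (z ∸ suc m)) (suc m ⊓ (z ∸ suc (suc m)))
⊓∸-lipschitz m z =
  ℕ.≤-trans (ℕ.⊓-mono-≤ (ℕ.≤-trans (ℕ.n≤1+n m) (ℕ.n≤1+n (suc m))) (≤suc-pred (z ∸ suc m)))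
    (ℕ.≤-reflexive (trans (cong (λ x → suc (suc m ⊓ x)) (ℕ.pred[m∸n]≡m∸[1+n] z (suc m)))
      (ℕ.+-comm 1 _))) ,
  ℕ.≤-trans (ℕ.⊓-mono-≤ (ℕ.≤-refl {suc m}) (ℕ.≤-trans (ℕ.∸-monoʳ-≤ z (ℕ.n≤1+n (suc m))) (ℕ.n≤1+n _)))
    (ℕ.≤-reflexive (ℕ.+-comm 1 _))
  where
  ≤suc-pred : ∀ x → x ≤ suc (pred x)
  ≤suc-pred zero    = z≤n
  ≤suc-pred (suc x) = ℕ.≤-refl

-- w ≡ r or w ≡ -r modulo d, with multiples of d on both sides so that nothing is subtracted.
NearMultiple : ℕ → ℕ → ℕ → Set
NearMultiple d w r = ∃[ m ] ∃[ m′ ] (w + m * d ≡ r + m′ * d ⊎ w + m * d + r ≡ m′ * d)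

-- depth x is the distance, on the circle ℤ/d, from x to the nearer end of the
-- arc [0 , e) or of its complement, whichever contains x.
module Circle (d e : ℕ) (0<e : 0 < e) (e<d : e < d) where

  instance
    d-nonZero : NonZero d
    d-nonZero = >-nonZero (ℕ.≤-<-trans z≤n e<d)

  pick : {A : Set} → Dec A → ℕ → ℕ → ℕ
  pick (yes _) m n = m
  pick (no  _) m n = n

  inner outer : ℕ → ℕ
  inner x = x ⊓ (e ∸ suc x)
  outer x = (x ∸ e) ⊓ (d ∸ suc x)

  depth tent : ℕ → ℕ
  depth x = pick (x <? e) (inner x) (outer x)
  -- The level e is high enough for the subtraction inside the arc to be exact, by `suc-2*inner≤e`.
  tent  x = pick (x <? e) (e ∸ suc (2 * inner x)) (e + suc (2 * outer x))

  pick-yes : {A : Set} (A? : Dec A) {m n : ℕ} → A → pick A? m n ≡ m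
  pick-yes (yes _) _ = refl
  pick-yes (no ¬a) a = contradiction a ¬a

  pick-no : {A : Set} (A? : Dec A) {m n : ℕ} → ¬ A → pick A? m n ≡ n
  pick-no (yes a) ¬a = contradiction a ¬a
  pick-no (no _)  _  = refl

  depth-inside : ∀ {x} → x < e → depth x ≡ inner x
  depth-inside {x} = pick-yes (x <? e)

  depth-outside : ∀ {x} → ¬ x < e → depth x ≡ outer x
  depth-outside {x} = pick-no (x <? e)

  suc-2*inner≤e : ∀ {x} → x < e → suc (2 * inner x) ≤ e
  suc-2*inner≤e {x} x<e = begin
    suc (2 * inner x)             ≡⟨ cong (λ z → suc (inner x + z)) (ℕ.+-identityʳ (inner x)) ⟩
    suc (inner x) + inner x       ≤⟨ ℕ.+-mono-≤ (s≤s (ℕ.m⊓n≤m x _)) (ℕ.m⊓n≤n x (e ∸ suc x)) ⟩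
    suc x + (e ∸ suc x)           ≡⟨ ℕ.m+[n∸m]≡n x<e ⟩
    e                             ∎
    where open ℕ.≤-Reasoning

  tent-inside : ∀ {x} → x < e → tent x + suc (2 * depth x) ≡ e
  tent-inside {x} x<e = trans
    (cong₂ (λ p q → p + suc (2 * q)) (pick-yes (x <? e) x<e) (depth-inside x<e))
    (ℕ.m∸n+n≡m (suc-2*inner≤e x<e))

  tent-outside : ∀ {x} → ¬ x < e → tent x ≡ e + suc (2 * depth x)
  tent-outside {x} x≮e = trans (pick-no (x <? e) x≮e)
    (cong (λ q → e + suc (2 * q)) (sym (depth-outside x≮e)))

  double : ∀ {m n} → m ≤ n + 1 → suc (2 * m) ≤ suc (2 * n) + 2
  double {m} {n} m≤ = s≤s (ℕ.≤-trans (ℕ.*-monoʳ-≤ 2 m≤) (ℕ.≤-reflexive (ℕ.*-distribˡ-+ 2 n 1)))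

  -- Both arcs end where the depth is 0; there the tent jumps from e ∸ 1 to e + 1.
  across : ∀ {x x′} → x < e → inner x ≡ 0 → ¬ x′ < e → outer x′ ≡ 0 → Within 2 (tent x) (tent x′)
  across {x} {x′} x<e in≡0 x′≮e out≡0 = subst₂ (Within 2)
    (sym (trans (pick-yes (x <? e) x<e) (cong (λ z → e ∸ suc (2 * z)) in≡0)))
    (sym (trans (pick-no (x′ <? e) x′≮e) (cong (λ z → e + suc (2 * z)) out≡0)))
    (ℕ.≤-trans (ℕ.m∸n≤m e 1) (ℕ.≤-trans (ℕ.m≤m+n e 1) (ℕ.m≤m+n (e + 1) 2)) ,
     ℕ.≤-reflexive (trans (cong (_+ 1) (sym (ℕ.m∸n+n≡m 0<e))) (ℕ.+-assoc (e ∸ 1) 1 1)))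

  tent-step : ∀ {x} → suc x < d → Within 2 (tent x) (tent (suc x))
  tent-step {x} sx<d = by-cases (x <? e) (suc x <? e)
    where
    by-cases : Dec (x < e) → Dec (suc x < e) → Within 2 (tent x) (tent (suc x))
    by-cases (yes x<e) (yes sx<e) with ≤suc , suc≤ ← ⊓∸-lipschitz x e = subst₂ (Within 2)
      (sym (pick-yes (x <? e) x<e)) (sym (pick-yes (suc x <? e) sx<e))
      (antitone {suc (2 * inner (suc x))} {suc (2 * inner x)} (double {inner (suc x)} {inner x} suc≤) ,
       antitone {suc (2 * inner x)} {suc (2 * inner (suc x))} (double {inner x} {inner (suc x)} ≤suc))
      where
      antitone : ∀ {m n} → m ≤ n + 2 → e ∸ n ≤ e ∸ m + 2
      antitone {m} {n} m≤ = ℕ.m≤n+o⇒m∸n≤o e n (ℕ.≤-trans (ℕ.m≤n+m∸n e m)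
        (ℕ.≤-trans (ℕ.+-monoˡ-≤ (e ∸ m) m≤) (ℕ.≤-reflexive (regroup n 2 (e ∸ m)))))
        where
        regroup : ∀ a b c → a + b + c ≡ a + (c + b)
        regroup = solve-∀
    -- Here x is the last place of the arc and `suc x` = e the first one outside, both of depth 0.
    by-cases (yes x<e) (no sx≮e) with refl ← ℕ.≤-antisym x<e (ℕ.≮⇒≥ sx≮e) =
      across x<e (trans (cong (x ⊓_) (ℕ.n∸n≡0 (suc x))) (ℕ.⊓-zeroʳ x))
        sx≮e (cong (_⊓ (d ∸ suc (suc x))) (ℕ.n∸n≡0 (suc x)))
    by-cases (no x≮e) (yes sx<e) = contradiction (ℕ.<-trans (ℕ.n<1+n x) sx<e) x≮e
    by-cases (no x≮e) (no sx≮e) = subst₂ (Within 2)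
      (sym (pick-no (x <? e) x≮e)) (sym (pick-no (suc x <? e) sx≮e))
      (add (double {outer x} {outer (suc x)} (proj₁ outer-step)) ,
       add (double {outer (suc x)} {outer x} (proj₂ outer-step)))
      where
      e≤x : e ≤ x
      e≤x = ℕ.≮⇒≥ x≮e
      add : ∀ {m n} → m ≤ n + 2 → e + m ≤ e + n + 2
      add {m} {n} m≤ = ℕ.≤-trans (ℕ.+-monoʳ-≤ e m≤) (ℕ.≤-reflexive (sym (ℕ.+-assoc e n 2)))
      -- Measured from e, the complement is an arc of length `d ∸ e`, on which `outer` has the same
      -- form as `inner`.
      shift : ∀ z → d ∸ e ∸ suc (z ∸ e) ≡ d ∸ suc (e + (z ∸ e))
      shift z = trans (ℕ.∸-+-assoc d e (suc (z ∸ e))) (cong (d ∸_) (ℕ.+-suc e (z ∸ e)))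
      outer-step : Within 1 (outer x) (outer (suc x))
      outer-step = subst₂ (Within 1)
        (cong ((x ∸ e) ⊓_) (trans (shift x) (cong (λ z → d ∸ suc z) (ℕ.m+[n∸m]≡n e≤x))))
        (cong₂ _⊓_ (sym (ℕ.+-∸-assoc 1 e≤x))
          (trans (cong (λ z → d ∸ e ∸ suc z) (sym (ℕ.+-∸-assoc 1 e≤x)))
            (trans (shift (suc x)) (cong (λ z → d ∸ suc z) (ℕ.m+[n∸m]≡n (ℕ.m≤n⇒m≤1+n e≤x))))))
        (⊓∸-lipschitz (x ∸ e) (d ∸ e))

  tent-wrap : ∀ {x} → suc x ≡ d → Within 2 (tent x) (tent 0)
  tent-wrap {x} sx≡d = Within-sym (across 0<e refl (λ x<e → ℕ.<⇒≱ e<d (subst (_≤ e) sx≡d x<e))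
    (trans (cong (λ z → (x ∸ e) ⊓ (d ∸ z)) sx≡d) (trans (cong ((x ∸ e) ⊓_) (ℕ.n∸n≡0 d)) (ℕ.⊓-zeroʳ (x ∸ e)))))

  tent-lipschitz : ∀ c r → Within (2 * r) (tent (c % d)) (tent ((c + r) % d))
  tent-lipschitz c zero    rewrite ℕ.+-identityʳ c = ℕ.m≤m+n _ 0 , ℕ.m≤m+n _ 0
  tent-lipschitz c (suc r) rewrite ℕ.+-suc c r =
    Within-weaken (ℕ.≤-reflexive (trans (ℕ.+-comm (2 * r) 2) (sym (ℕ.*-suc 2 r))))
      (Within-trans (tent-lipschitz c r) (one (c + r)))
    where
    one : ∀ m → Within 2 (tent (m % d)) (tent (suc m % d))
    one m with suc-% m d
    ... | inj₁ (sm<d , eq) = subst (Within 2 (tent (m % d)) ∘ tent) (sym eq) (tent-step sm<d)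
    ... | inj₂ (sm≡d , eq) = subst (Within 2 (tent (m % d)) ∘ tent) (sym eq) (tent-wrap sm≡d)

  tent-near : ∀ {w r} → NearMultiple d w r → ∀ c → Within (2 * r) (tent (c % d)) (tent ((c + w) % d))
  tent-near {w} {r} (m , m′ , inj₁ eq) c =
    subst (Within (2 * r) (tent (c % d)) ∘ tent) (begin
      (c + r) % d             ≡⟨ [m+kn]%n≡m%n (c + r) m′ d ⟨
      (c + r + m′ * d) % d    ≡⟨ cong (_% d) (trans (ℕ.+-assoc c r _) (trans (cong (c +_) (sym eq)) (sym (ℕ.+-assoc c w _)))) ⟩
      (c + w + m * d) % d     ≡⟨ [m+kn]%n≡m%n (c + w) m d ⟩
      (c + w) % d             ∎)
      (tent-lipschitz c r)
    where open ≡-Reasoning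
  -- Now w ≡ -r, so r steps forward from c + w lead back to c.
  tent-near {w} {r} (m , m′ , inj₂ eq) c = Within-sym
    (subst (Within (2 * r) (tent ((c + w) % d)) ∘ tent) (begin
      (c + w + r) % d           ≡⟨ [m+kn]%n≡m%n (c + w + r) m d ⟨
      (c + w + r + m * d) % d   ≡⟨ cong (_% d) (trans (regroup c w r (m * d)) (cong (c +_) eq)) ⟩
      (c + m′ * d) % d          ≡⟨ [m+kn]%n≡m%n c m′ d ⟩
      c % d                     ∎)
      (tent-lipschitz (c + w) r))
    where
    open ≡-Reasoning
    regroup : ∀ c w r x → c + w + r + x ≡ c + (w + x + r)
    regroup = solve-∀

-- The rotation input

module Rotation (d g κ t : ℕ) .{{_ : NonZero d}} .{{_ : NonZero g}} (coprime : Coprime d κ) where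

  angle : ℕ → ℕ
  angle i = (κ * i + t) % d

  -- The rank by angle first and by block of d positions second. As κ is coprime to d, each angle
  -- occurs once in each of the g blocks, so the keys below `l * g` are those with angle below l.
  key : ℕ → ℕ
  key i = angle i * g + i / d

  angle<d : ∀ i → angle i < d
  angle<d i = m%n<n (κ * i + t) d

  key≥ : ∀ {l i} → l ≤ angle i → l * g ≤ key i
  key≥ {l} {i} l≤ = ℕ.≤-trans (ℕ.*-monoˡ-≤ g l≤) (ℕ.m≤m+n (angle i * g) (i / d))

  key< : ∀ {l i} → i < g * d → angle i < l → key i < l * g
  key< {l} {i} i<gd <l = ℕ.≤-trans (ℕ.+-monoʳ-< (angle i * g) (m<n*o⇒m/o<n {n = g} i<gd))
    (ℕ.≤-trans (ℕ.≤-reflexive (ℕ.+-comm (angle i * g) g)) (ℕ.*-monoˡ-≤ g <l))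

  -- Equal keys force equal angles and equal blocks. Then d divides κ times the difference of the
  -- positions, hence the difference itself, which within a block is less than d.
  key-injective : ∀ {i j} → i < g * d → j < g * d → key i ≡ key j → i ≡ j
  key-injective {i} {j} i<gd j<gd eq =
    ℕ.≤-antisym (ℕ.m∸n≡0⇒m≤n (∸≡0 (sym angle≡) (sym block≡))) (ℕ.m∸n≡0⇒m≤n (∸≡0 angle≡ block≡))
    where
    angle≡ : angle i ≡ angle j
    angle≡ = ℕ.≤-antisym
      (ℕ.≮⇒≥ (λ j<i → ℕ.<⇒≱ (key< {angle i} j<gd j<i) (ℕ.≤-trans (key≥ ℕ.≤-refl) (ℕ.≤-reflexive eq))))
      (ℕ.≮⇒≥ (λ i<j → ℕ.<⇒≱ (key< {angle j} i<gd i<j) (ℕ.≤-trans (key≥ ℕ.≤-refl) (ℕ.≤-reflexive (sym eq)))))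
    block≡ : i / d ≡ j / d
    block≡ = ℕ.+-cancelˡ-≡ (angle j * g) _ _ (trans (cong (λ x → x * g + i / d) (sym angle≡)) eq)

    ∸≡0 : ∀ {i j} → angle i ≡ angle j → i / d ≡ j / d → j ∸ i ≡ 0
    ∸≡0 {i} {j} angle≡ block≡ = ∣∧<⇒≡0 (coprime-divisor coprime
      (subst (d ∣_) (trans (trans (cong₂ _∸_ (ℕ.+-comm (κ * j) t) (ℕ.+-comm (κ * i) t)) (ℕ.[m+n]∸[m+o]≡n∸o t (κ * j) (κ * i))) (sym (ℕ.*-distribˡ-∸ κ j i)))
        (%-≡⇒∣∸ (κ * i + t) (κ * j + t) d angle≡)))
      (ℕ.≤-<-trans (ℕ.≤-trans (ℕ.≤-reflexive gap≡) (ℕ.m∸n≤m (j % d) (i % d))) (m%n<n j d))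
      where
      gap≡ : j ∸ i ≡ j % d ∸ i % d
      gap≡ = trans (cong₂ _∸_
          (trans (m≡m%n+[m/n]*n j d) (ℕ.+-comm (j % d) _))
          (trans (m≡m%n+[m/n]*n i d) (trans (ℕ.+-comm (i % d) _) (cong (λ q → q * d + i % d) block≡))))
        (ℕ.[m+n]∸[m+o]≡n∸o (j / d * d) (j % d) (i % d))

-- Averaging over the rotations

rotation-count : ∀ d .{{_ : NonZero d}} c {e} → e ≤ d → ∑[ t < d ] 𝟙 ((c + toℕ t) % d <? e) ≡ e
rotation-count d c e≤d = count-below {f = λ t → (c + toℕ t) % d} (λ {t} {t′} eq →
  Fin.toℕ-injective (ℕ.≤-antisym (ℕ.m∸n≡0⇒m≤n (∸≡0 t′ t (sym eq))) (ℕ.m∸n≡0⇒m≤n (∸≡0 t t′ eq))))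
  (λ t → m%n<n (c + toℕ t) d) e≤d
  where
  ∸≡0 : ∀ (t t′ : Fin d) → (c + toℕ t) % d ≡ (c + toℕ t′) % d → toℕ t′ ∸ toℕ t ≡ 0
  ∸≡0 t t′ eq = ∣∧<⇒≡0
    (subst (d ∣_) (ℕ.[m+n]∸[m+o]≡n∸o c (toℕ t′) (toℕ t)) (%-≡⇒∣∸ (c + toℕ t) (c + toℕ t′) d eq))
    (ℕ.≤-<-trans (ℕ.m∸n≤m (toℕ t′) (toℕ t)) (Fin.toℕ<n t′))

sum≤*-max : ∀ {d} .{{_ : NonZero d}} (f : Fin d → ℕ) → ∃[ t ] sum f ≤ d * f t
sum≤*-max {suc zero}    f = zero , ℕ.≤-refl
sum≤*-max {suc (suc d)} f with sum≤*-max (f ∘ suc)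
... | t , tail≤ with ℕ.≤-total (f zero) (f (suc t))
...   | inj₁ f0≤ = suc t , ℕ.+-mono-≤ f0≤ tail≤
...   | inj₂ ≤f0 = zero , ℕ.+-monoʳ-≤ (f zero) (ℕ.≤-trans tail≤ (ℕ.*-monoʳ-≤ (suc d) ≤f0))

-- With e = ⌊d/2⌋ the slack is e² for even d and (e - 1)(e + 2) for odd d. Equality at d = 3 fixes
-- the constant 9, and with it the later 81.
half-product : ∀ d → 2 ≤ d → 2 * (d * d) ≤ 9 * ((d ∸ d / 2) * (d / 2))
half-product d 2≤d = by-cases (d / 2) (d % 2) (m%n<n d 2) (m≡m%n+[m/n]*n d 2)
  where
  by-cases : ∀ e r → r < 2 → d ≡ r + e * 2 → 2 * (d * d) ≤ 9 * ((d ∸ e) * e)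
  by-cases zero    r r<2 eq = contradiction 2≤d
    (ℕ.<⇒≱ (subst (_< 2) (trans (sym (ℕ.+-identityʳ r)) (sym eq)) r<2))
  by-cases (suc e) 0 _ refl = subst (λ x → 2 * (suc e * 2 * (suc e * 2)) ≤ 9 * (x * suc e))
    (sym (trans (cong (_∸ suc e) (rearrange e)) (ℕ.m+n∸n≡m (suc e) (suc e))))
    (subst (2 * (suc e * 2 * (suc e * 2)) ≤_) (expand e) (ℕ.m≤m+n _ (suc e * suc e)))
    where
    rearrange : ∀ e → suc e * 2 ≡ suc e + suc e
    rearrange = solve-∀
    expand : ∀ e → 2 * (suc e * 2 * (suc e * 2)) + suc e * suc e ≡ 9 * (suc e * suc e)
    expand = solve-∀
  by-cases (suc e) 1 _ refl = subst (λ x → 2 * ((1 + suc e * 2) * (1 + suc e * 2)) ≤ 9 * (x * suc e))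
    (sym (trans (cong (_∸ suc e) (rearrange e)) (ℕ.m+n∸n≡m (suc (suc e)) (suc e))))
    (subst (2 * ((1 + suc e * 2) * (1 + suc e * 2)) ≤_) (expand e) (ℕ.m≤m+n _ (e * e + 3 * e)))
    where
    rearrange : ∀ e → 1 + suc e * 2 ≡ suc (suc e) + suc e
    rearrange = solve-∀
    expand : ∀ e → 2 * ((1 + suc e * 2) * (1 + suc e * 2)) + (e * e + 3 * e) ≡ 9 * (suc (suc e) * suc e)
    expand = solve-∀
  by-cases (suc e) (suc (suc _)) (s≤s (s≤s ())) _

-- `inputs` lists arrays of the form `Vec.lookup v`. Starting from a vector gives membership
-- directly, without identifying functions that agree pointwise.
exchanges≤W : ∀ {n p} (H : GapSequence p) (v : Vec (Fin n) n) → Unique v → exchanges H (Vec.lookup v) ≤ W n H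
exchanges≤W {n} H v unique = All.lookup (Nat.xs≤max 0 (List.map (exchanges H) (inputs n)))
  (∈-map⁺ (exchanges H) (∈-map⁺ Vec.lookup (∈-filter⁺ unique? (∈-vectors v) unique)))
  where
  ∈-vectors : ∀ {m} (v : Vec (Fin n) m) → v ∈ vectors m (List.allFin n)
  ∈-vectors []      = Any.here refl
  ∈-vectors (i ∷ v) = ∈-cartesianProductWith⁺ _∷_ (∈-allFin i) (∈-vectors v)

module _ {n p} (H : GapSequence p) (s : Fin p)
  (d g κ r : ℕ) .{{_ : NonZero g}} (2≤d : 2 ≤ d) (n≡g*d : n ≡ g * d) (coprime : Coprime d κ)
  (near-multiples : ∀ j → toℕ j < toℕ s →
                    ∃[ r′ ] r′ ≤ r × NearMultiple d (κ * GapSequence.gap H j) r′) where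

  open GapSequence H

  private
    instance
      d≢0 : NonZero d
      d≢0 = >-nonZero (ℕ.≤-trans (s≤s z≤n) 2≤d)

    e α : ℕ
    e = d / 2
    α = e * g

    0<e : 0 < e
    0<e = m≥n⇒m/n>0 2≤d

    e<d : e < d
    e<d = m/n<m d 2 ℕ.≤-refl

    n≡d*g : n ≡ d * g
    n≡d*g = trans n≡g*d (ℕ.*-comm g d)

    α≤n : α ≤ n
    α≤n = ℕ.≤-trans (ℕ.*-monoˡ-≤ g (ℕ.<⇒≤ e<d)) (ℕ.≤-reflexive (sym n≡d*g))

    initial? : ∀ (i : Fin n) → Dec (toℕ i < α)
    initial? i = toℕ i <? α

    <g*d : ∀ (i : Fin n) → toℕ i < g * d
    <g*d i = subst (toℕ i <_) n≡g*d (Fin.toℕ<n i)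

  open Circle d e 0<e e<d using (tent; depth; tent-inside; tent-outside;
    depth-inside; depth-outside; tent-near)

  module _ (t : ℕ) where

    open Rotation d g κ t coprime

    private
      key<n : ∀ (i : Fin n) → key (toℕ i) < n
      key<n i = subst (key (toℕ i) <_) (sym n≡d*g) (key< (<g*d i) (angle<d (toℕ i)))

      x : Fin n → ℕ
      x i = angle (toℕ i)

    rotation : Vec (Fin n) n
    rotation = Vec.tabulate (λ i → Fin.fromℕ< (key<n i))

    rotated : Array n
    rotated = Vec.lookup rotation

    private
      rotated≡ : ∀ i → toℕ (rotated i) ≡ key (toℕ i)
      rotated≡ i = trans (cong toℕ (Vec.lookup∘tabulate _ i)) (Fin.toℕ-fromℕ< (key<n i))

      keys-injective : Injective _≡_ _≡_ (λ (i : Fin n) → key (toℕ i))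
      keys-injective {i} {j} eq = Fin.toℕ-injective (key-injective (<g*d i) (<g*d j) eq)

      low⇒ : ∀ i → toℕ (rotated i) < α → x i < e
      low⇒ i low = ℕ.≰⇒> (λ e≤x → ℕ.<⇒≱ (subst (_< α) (rotated≡ i) low) (key≥ e≤x))

      low⇐ : ∀ i → x i < e → toℕ (rotated i) < α
      low⇐ i x<e = subst (_< α) (sym (rotated≡ i)) (key< (<g*d i) x<e)

      count-arc : ∀ b l {P : Fin n → Set} (P? : ∀ i → Dec (P i)) →
                  (∀ i → P i → b ≤ x i × x i < b + l) → ∑[ i < n ] 𝟙 (P? i) ≤ l * g
      count-arc b l P? range = count-injective-≤ keys-injective P? (b * g) (l * g) (λ i Pi →
        key≥ (proj₁ (range i Pi)) ,
        subst (key (toℕ i) <_) (ℕ.*-distribʳ-+ g b l) (key< (<g*d i) (proj₂ (range i Pi))))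

      -- A minimum is below l only if one of its arguments is. Each argument confines the angle to l
      -- consecutive values, and each angle is taken by at most g positions; the two ends of an arc
      -- give the factor 2.
      count-⊓ : ∀ {P : Fin n → Set} (P? : ∀ i → Dec (P i)) l (y u v : Fin n → ℕ) b c →
                (∀ i → P i → y i ≡ u i ⊓ v i) →
                (∀ i → P i → u i < l → b ≤ x i × x i < b + l) →
                (∀ i → P i → v i < l → c ≤ x i × x i < c + l) →
                ∑[ i < n ] (𝟙 (P? i) * 𝟙 (y i <? l)) ≤ 2 * g * l
      count-⊓ P? l y u v b c y≡ range-u range-v = begin
        ∑[ i < n ] (𝟙 (P? i) * 𝟙 (y i <? l))
          ≤⟨ sum-mono-≤ {n} (λ i → ℕ.≤-trans (ℕ.≤-reflexive (𝟙-× (P? i) (y i <? l)))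
               (𝟙-∪ (P? i ×-dec (y i <? l)) (P? i ×-dec (u i <? l)) (P? i ×-dec (v i <? l)) (split i))) ⟩
        ∑[ i < n ] (𝟙 (P? i ×-dec (u i <? l)) + 𝟙 (P? i ×-dec (v i <? l)))
          ≡⟨ ∑-distrib-+ {n} (λ i → 𝟙 (P? i ×-dec (u i <? l))) (λ i → 𝟙 (P? i ×-dec (v i <? l))) ⟩
        ∑[ i < n ] 𝟙 (P? i ×-dec (u i <? l)) + ∑[ i < n ] 𝟙 (P? i ×-dec (v i <? l))
          ≤⟨ ℕ.+-mono-≤
               (count-arc b l (λ i → P? i ×-dec (u i <? l)) (λ i (Pi , <l) → range-u i Pi <l))
               (count-arc c l (λ i → P? i ×-dec (v i <? l)) (λ i (Pi , <l) → range-v i Pi <l)) ⟩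
        l * g + l * g
          ≡⟨ regroup l g ⟩
        2 * g * l ∎
        where
        open ℕ.≤-Reasoning
        regroup : ∀ l g → l * g + l * g ≡ 2 * g * l
        regroup = solve-∀
        split : ∀ i → _ → _ ⊎ _
        split i (Pi , y<l) with ℕ.⊓-sel (u i) (v i)
        ... | inj₁ eq = inj₁ (Pi , subst (_< l) (trans (y≡ i Pi) eq) y<l)
        ... | inj₂ eq = inj₂ (Pi , subst (_< l) (trans (y≡ i Pi) eq) y<l)

      upper-range : ∀ {z l x} → x < z → z ∸ suc x < l → z ∸ l ≤ x × x < (z ∸ l) + l
      upper-range {z} {l} {x} x<z <l = ℕ.m≤n+o⇒m∸n≤o z l z≤l+x ,
        ℕ.<-≤-trans x<z (ℕ.≤-trans (ℕ.m≤n+m∸n z l) (ℕ.≤-reflexive (ℕ.+-comm l (z ∸ l))))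
        where
        z≤l+x : z ≤ l + x
        z≤l+x = ℕ.≤-trans (ℕ.≤-reflexive (trans (sym (ℕ.m+[n∸m]≡n x<z)) (sym (ℕ.+-suc x _))))
          (ℕ.≤-trans (ℕ.+-monoʳ-≤ x <l) (ℕ.≤-reflexive (ℕ.+-comm x l)))

    rotated-distinct : Distinct rotated
    rotated-distinct i j eq =
      keys-injective (trans (sym (rotated≡ i)) (trans (cong toℕ eq) (rotated≡ j)))

    rotation-unique : Unique rotation
    rotation-unique = Unique.tabulate⁺ (λ {i} {j} eq → rotated-distinct i j
      (trans (Vec.lookup∘tabulate _ i) (trans eq (sym (Vec.lookup∘tabulate _ j)))))

    rotated-cost : ∣ low? α rotated ∖ initial? ∣ * ∣ low? α rotated ∖ initial? ∣
                    ≤ (2 * (g * r) + gap s) * exchanges H rotated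
    rotated-cost = displaced²≤cost H s rotated rotated-distinct α≤n
      -- Level e, at most `2 * g` positions per depth on either side, drift at most `2 * r` per
      -- exchange.
      (tent ∘ x) (depth ∘ x) {e} {2 * g} {2 * r} {2 * (g * r)} (scale g r)
      near
      (λ i low → tent-inside (low⇒ i low))
      (λ i high → tent-outside (high ∘ low⇐ i))
      (λ l → count-⊓ (low? α rotated) l (depth ∘ x) x (λ i → e ∸ suc (x i)) 0 (e ∸ l)
        (λ i low → depth-inside (low⇒ i low))
        (λ i _ x<l → z≤n , x<l)
        (λ i low <l → upper-range (low⇒ i low) <l))
      (λ l → count-⊓ (λ i → ¬? (low? α rotated i)) l (depth ∘ x)
        (λ i → x i ∸ e) (λ i → d ∸ suc (x i)) e (d ∸ l)
        (λ i high → depth-outside (high ∘ low⇐ i))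
        (λ i high <l → let e≤x = ℕ.≮⇒≥ (high ∘ low⇐ i) in
          e≤x , subst (_< e + l) (ℕ.m+[n∸m]≡n e≤x) (ℕ.+-monoʳ-< e <l))
        (λ i _ <l → upper-range (angle<d (toℕ i)) <l))
      where
      scale : ∀ g r → 2 * g * (2 * r) ≡ 2 * (2 * (g * r))
      scale = solve-∀
      near : ∀ j → toℕ j < toℕ s → Near (2 * r) (tent ∘ x) (gap j)
      near j j<s i i′ i′≡ = subst (λ z → Within (2 * r) (tent (x i)) (tent (z % d)))
        (trans (shift κ (toℕ i) t (gap j)) (cong (λ z → κ * z + t) (sym i′≡)))
        (Within-weaken (ℕ.*-monoʳ-≤ 2 (proj₁ (proj₂ (near-multiples j j<s))))
          (tent-near (proj₂ (proj₂ (near-multiples j j<s))) (κ * toℕ i + t)))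
        where
        shift : ∀ k i t h → k * i + t + k * h ≡ k * (i + h) + t
        shift = solve-∀

    displaced≡ : ∣ low? α rotated ∖ initial? ∣ ≡ ∑[ i < n ] (𝟙 (angle (toℕ i) <? e) * 𝟙 (¬? (initial? i)))
    displaced≡ = sum-cong-≗ {n} (λ i → cong (_* 𝟙 (¬? (initial? i)))
      (𝟙-cong (low? α rotated i) (x i <? e) (low⇒ i) (low⇐ i)))

  private
    displaced : Fin d → ℕ
    displaced t = ∣ low? α (rotated (toℕ t)) ∖ initial? ∣

    high-count : ∑[ i < n ] 𝟙 (¬? (initial? i)) ≡ n ∸ α
    high-count = trans (sym (ℕ.m+n∸m≡n α _)) (cong (_∸ α) (begin
      α + ∑[ i < n ] 𝟙 (¬? (initial? i))
        ≡⟨ cong (_+ ∑[ i < n ] 𝟙 (¬? (initial? i))) (count-below Fin.toℕ-injective Fin.toℕ<n α≤n) ⟨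
      ∑[ i < n ] 𝟙 (initial? i) + ∑[ i < n ] 𝟙 (¬? (initial? i))
        ≡⟨ ∑-distrib-+ {n} (λ i → 𝟙 (initial? i)) (λ i → 𝟙 (¬? (initial? i))) ⟨
      ∑[ i < n ] (𝟙 (initial? i) + 𝟙 (¬? (initial? i)))
        ≡⟨ sum-cong-≗ {n} (λ i → 𝟙+𝟙¬ (initial? i)) ⟩
      ∑[ i < n ] 1
        ≡⟨ trans (sum-const n 1) (ℕ.*-identityʳ n) ⟩
      n ∎))
      where open ≡-Reasoning

    -- Double counting: each of the `n ∸ α` positions from α on holds a small key in exactly e of
    -- the d rotations.
    displaced-total : sum displaced ≡ e * (n ∸ α)
    displaced-total = begin
      sum displaced
        ≡⟨ sum-cong-≗ {d} (λ t → displaced≡ (toℕ t)) ⟩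
      ∑[ t < d ] ∑[ i < n ] (𝟙 ((κ * toℕ i + toℕ t) % d <? e) * 𝟙 (¬? (initial? i)))
        ≡⟨ ∑-comm {d} {n} (λ t i → 𝟙 ((κ * toℕ i + toℕ t) % d <? e) * 𝟙 (¬? (initial? i))) ⟩
      ∑[ i < n ] ∑[ t < d ] (𝟙 ((κ * toℕ i + toℕ t) % d <? e) * 𝟙 (¬? (initial? i)))
        ≡⟨ sum-cong-≗ {n} (λ i → *-distribʳ-sum {d} (𝟙 (¬? (initial? i)))
             (λ t → 𝟙 ((κ * toℕ i + toℕ t) % d <? e))) ⟨
      ∑[ i < n ] (∑[ t < d ] 𝟙 ((κ * toℕ i + toℕ t) % d <? e) * 𝟙 (¬? (initial? i)))
        ≡⟨ sum-cong-≗ {n} (λ i → cong (_* 𝟙 (¬? (initial? i)))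
             (rotation-count d (κ * toℕ i) (ℕ.<⇒≤ e<d))) ⟩
      ∑[ i < n ] (e * 𝟙 (¬? (initial? i)))
        ≡⟨ *-distribˡ-sum {n} e (λ i → 𝟙 (¬? (initial? i))) ⟨
      e * ∑[ i < n ] 𝟙 (¬? (initial? i))
        ≡⟨ cong (e *_) high-count ⟩
      e * (n ∸ α) ∎
      where open ≡-Reasoning

    many-displaced : ∃[ t ] 2 * n ≤ 9 * displaced t
    many-displaced = t , ℕ.*-cancelˡ-≤ d (begin
        d * (2 * n)
          ≡⟨ cong (λ z → d * (2 * z)) n≡d*g ⟩
        d * (2 * (d * g))
          ≡⟨ regroup₁ d g ⟩
        2 * (d * d) * g
          ≤⟨ ℕ.*-monoˡ-≤ g (half-product d 2≤d) ⟩
        9 * ((d ∸ e) * e) * g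
          ≡⟨ regroup₂ (d ∸ e) e g ⟩
        9 * (e * ((d ∸ e) * g))
          ≡⟨ cong (λ z → 9 * (e * z)) (trans (ℕ.*-distribʳ-∸ g d e) (cong (_∸ α) (sym n≡d*g))) ⟩
        9 * (e * (n ∸ α))
          ≡⟨ cong (9 *_) displaced-total ⟨
        9 * sum displaced
          ≤⟨ ℕ.*-monoʳ-≤ 9 (proj₂ (sum≤*-max displaced)) ⟩
        9 * (d * displaced t)
          ≡⟨ regroup₃ d (displaced t) ⟩
        d * (9 * displaced t) ∎)
      where
      open ℕ.≤-Reasoning
      t : Fin d
      t = proj₁ (sum≤*-max displaced)
      regroup₁ : ∀ d g → d * (2 * (d * g)) ≡ 2 * (d * d) * g
      regroup₁ = solve-∀
      regroup₂ : ∀ f e g → 9 * (f * e) * g ≡ 9 * (e * (f * g))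
      regroup₂ = solve-∀
      regroup₃ : ∀ d m → 9 * (d * m) ≡ d * (9 * m)
      regroup₃ = solve-∀

  n²≤cost : 4 * (n * n) ≤ 81 * ((2 * (g * r) + gap s) * W n H)
  n²≤cost = begin
    4 * (n * n)
      ≡⟨ sym (ℕ.[m*n]*[o*p]≡[m*o]*[n*p] 2 n 2 n) ⟩
    2 * n * (2 * n)
      ≤⟨ ℕ.*-mono-≤ (proj₂ many-displaced) (proj₂ many-displaced) ⟩
    9 * displaced t * (9 * displaced t)
      ≡⟨ ℕ.[m*n]*[o*p]≡[m*o]*[n*p] 9 (displaced t) 9 (displaced t) ⟩
    81 * (displaced t * displaced t)
      ≤⟨ ℕ.*-monoʳ-≤ 81 (rotated-cost (toℕ t)) ⟩
    81 * ((2 * (g * r) + gap s) * exchanges H (rotated (toℕ t)))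
      ≤⟨ ℕ.*-monoʳ-≤ 81 (ℕ.*-monoʳ-≤ (2 * (g * r) + gap s)
           (exchanges≤W H (rotation (toℕ t)) (rotation-unique (toℕ t)))) ⟩
    81 * ((2 * (g * r) + gap s) * W n H) ∎
    where
    open ℕ.≤-Reasoning
    t : Fin d
    t = proj₁ many-displaced

-- The minimum β as a fraction with denominator n

gcd-split : ∀ n k → 0 < k → k < n → ∃[ g ] ∃[ d ] ∃[ κ ]
            NonZero g × 2 ≤ d × n ≡ g * d × k ≡ g * κ × Coprime d κ
gcd-split n k 0<k k<n with gcd[m,n]∣m n k | gcd[m,n]∣n n k
... | divides d n≡ | divides κ k≡ = g , d , κ , >-nonZero 0<g , 2≤d ,
  trans n≡ (ℕ.*-comm d g) , trans k≡ (ℕ.*-comm κ g) , coprime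
  where
  g : ℕ
  g = gcd n k
  0<g : 0 < g
  0<g = ℕ.n≢0⇒n>0 (λ g≡0 → ℕ.<⇒≢ 0<k (sym (trans k≡ (trans (cong (κ *_) g≡0) (ℕ.*-zeroʳ κ)))))
  g≤k : g ≤ k
  g≤k = ∣⇒≤ {{>-nonZero 0<k}} (gcd[m,n]∣n n k)
  2≤d : 2 ≤ d
  2≤d = ℕ.≰⇒> (λ d≤1 → ℕ.<⇒≱ k<n (ℕ.≤-trans (ℕ.≤-reflexive n≡)
    (ℕ.≤-trans (ℕ.*-monoˡ-≤ g d≤1) (ℕ.≤-trans (ℕ.≤-reflexive (ℕ.*-identityˡ g)) g≤k))))
  coprime : Coprime d κ
  coprime {c} (c∣d , c∣κ) = ∣1⇒≡1 (*-cancelʳ-∣ g {{>-nonZero 0<g}}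
    (subst (c * g ∣_) (sym (ℕ.*-identityˡ g))
      (gcd-greatest (subst (c * g ∣_) (sym n≡) (*-monoˡ-∣ g c∣d)) (subst (c * g ∣_) (sym k≡) (*-monoˡ-∣ g c∣κ)))))

nearMultiple-abs : ∀ w z d → NearMultiple d w ℤ.∣ ℤ.+ w ℤ.- z ℤ.* ℤ.+ d ∣
nearMultiple-abs w (ℤ.+ m) d = by-cases (ℕ.≤-total (m * d) w)
  where
  abs≡ : ℤ.∣ ℤ.+ w ℤ.- ℤ.+ m ℤ.* ℤ.+ d ∣ ≡ ℤ.∣ w ℤ.⊖ m * d ∣
  abs≡ = cong ℤ.∣_∣ (trans (cong (λ x → ℤ.+ w ℤ.- x) (sym (ℤ.pos-* m d))) (ℤ.m-n≡m⊖n w (m * d)))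
  by-cases : m * d ≤ w ⊎ w ≤ m * d → NearMultiple d w ℤ.∣ ℤ.+ w ℤ.- ℤ.+ m ℤ.* ℤ.+ d ∣
  by-cases (inj₁ md≤w) = 0 , m , inj₁ (trans (ℕ.+-identityʳ w) (trans (sym (ℕ.m∸n+n≡m md≤w))
    (cong (_+ m * d) (sym (trans abs≡ (cong ℤ.∣_∣ (ℤ.⊖-≥ md≤w)))))))
  by-cases (inj₂ w≤md) = 0 , m , inj₂ (trans (cong (_+ ℤ.∣ ℤ.+ w ℤ.- ℤ.+ m ℤ.* ℤ.+ d ∣) (ℕ.+-identityʳ w))
    (trans (cong (w +_) (trans abs≡ (ℤ.∣⊖∣-≤ w≤md))) (ℕ.m+[n∸m]≡n w≤md)))
nearMultiple-abs w ℤ.-[1+ m ] d = suc m , 0 , inj₁ (trans (cong ℤ.∣_∣ sum≡) (sym (ℕ.+-identityʳ _)))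
  where
  sum≡ : ℤ.+ (w + suc m * d) ≡ ℤ.+ w ℤ.- ℤ.-[1+ m ] ℤ.* ℤ.+ d
  sum≡ = cong (λ x → ℤ.+ w ℤ.+ x) (trans (ℤ.pos-* (suc m) d) (sym (ℤ.neg-distribˡ-* ℤ.-[1+ m ] (ℤ.+ d))))

-- If z is the rounded value, then gκw - zn = g(κw - zd). The factor g comes out of the numerator,
-- and |κw - zd| is congruent to κw modulo d up to sign.
norm-fraction : ∀ g d κ w n .{{_ : NonZero n}} → n ≡ g * d →
                ∃[ r ] ‖ ℤ.+ (g * κ * w) ℚ./ n ‖ ≡ ℤ.+ (g * r) ℚ./ n × NearMultiple d (κ * w) r
norm-fraction g d κ w n@(suc n-1) n≡ = r , norm≡ , nearMultiple-abs (κ * w) z d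
  where
  z : ℤ.ℤ
  z = ℚ.round (ℤ.+ (g * κ * w) ℚ./ n)
  r : ℕ
  r = ℤ.∣ ℤ.+ (κ * w) ℤ.- z ℤ.* ℤ.+ d ∣

  numerator : ℤ.+ (g * κ * w) ℤ.* ℤ.1ℤ ℤ.+ (ℤ.- z) ℤ.* ℤ.+ n ≡ ℤ.+ g ℤ.* (ℤ.+ (κ * w) ℤ.- z ℤ.* ℤ.+ d)
  numerator = trans
    (cong₂ (λ a b → a ℤ.* ℤ.1ℤ ℤ.+ (ℤ.- z) ℤ.* b)
      (trans (cong ℤ.+_ (ℕ.*-assoc g κ w)) (ℤ.pos-* g (κ * w)))
      (trans (cong ℤ.+_ n≡) (ℤ.pos-* g d)))
    (solveℤ 4 (λ g a z d → g :* a :* con ℤ.1ℤ :+ (:- z) :* (g :* d) := g :* (a :- z :* d)) refl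
      (ℤ.+ g) (ℤ.+ (κ * w)) z (ℤ.+ d))

  norm≡ : ‖ ℤ.+ (g * κ * w) ℚ./ n ‖ ≡ ℤ.+ (g * r) ℚ./ n
  norm≡ = ℚ.toℚᵘ-injective (begin
    ℚ.toℚᵘ ‖ ℤ.+ (g * κ * w) ℚ./ n ‖
      ≈⟨ ℚ.toℚᵘ-homo-∣-∣ (ℤ.+ (g * κ * w) ℚ./ n ℚ.- z ℚ./ 1) ⟩
    ℚᵘ.∣ ℚ.toℚᵘ (ℤ.+ (g * κ * w) ℚ./ n ℚ.- z ℚ./ 1) ∣
      ≈⟨ ℚᵘ.∣-∣-cong (ℚᵘ.≃-trans (ℚ.toℚᵘ-homo-+ (ℤ.+ (g * κ * w) ℚ./ n) (ℚ.- (z ℚ./ 1)))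
           (ℚᵘ.+-cong (ℚ.toℚᵘ-fromℚᵘ (ℚᵘ.mkℚᵘ (ℤ.+ (g * κ * w)) n-1))
             (ℚᵘ.≃-trans (ℚ.toℚᵘ-homo‿- (z ℚ./ 1)) (ℚᵘ.-‿cong (ℚ.toℚᵘ-fromℚᵘ (ℚᵘ.mkℚᵘ z 0)))))) ⟩
    ℚᵘ.∣ ℚᵘ.mkℚᵘ (ℤ.+ (g * κ * w)) n-1 ℚᵘ.- ℚᵘ.mkℚᵘ z 0 ∣
      ≈⟨ ℚᵘ.*≡* (cong₂ ℤ._*_
           (cong ℤ.+_ (trans (cong ℤ.∣_∣ numerator) (ℤ.abs-* (ℤ.+ g) (ℤ.+ (κ * w) ℤ.- z ℤ.* ℤ.+ d))))
           (cong ℤ.+_ (sym (ℕ.*-identityʳ n)))) ⟩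
    ℚᵘ.mkℚᵘ (ℤ.+ (g * r)) n-1
      ≈⟨ ℚ.toℚᵘ-fromℚᵘ (ℚᵘ.mkℚᵘ (ℤ.+ (g * r)) n-1) ⟨
    ℚ.toℚᵘ (ℤ.+ (g * r) ℚ./ n) ∎)
    where open ℚᵘ.≃-Reasoning

fraction-cancel-≤ : ∀ {a b} n .{{_ : NonZero n}} → ℤ.+ a ℚ./ n ℚ.≤ ℤ.+ b ℚ./ n → a ≤ b
fraction-cancel-≤ {a} {b} (suc n-1) le = drop (ℚᵘ.≤-respˡ-≃ (ℚ.toℚᵘ-fromℚᵘ (ℚᵘ.mkℚᵘ (ℤ.+ a) n-1))
  (ℚᵘ.≤-respʳ-≃ (ℚ.toℚᵘ-fromℚᵘ (ℚᵘ.mkℚᵘ (ℤ.+ b) n-1)) (ℚ.toℚᵘ-mono-≤ le)))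
  where
  drop : ℚᵘ.mkℚᵘ (ℤ.+ a) n-1 ℚᵘ.≤ ℚᵘ.mkℚᵘ (ℤ.+ b) n-1 → a ≤ b
  drop (ℚᵘ.*≤* le) = ℤ.drop‿+≤+ (ℤ.*-cancelʳ-≤-pos (ℤ.+ a) (ℤ.+ b) (ℤ.+ suc n-1) le)

module Extremaℚ = Data.List.Extrema (DecTotalOrder.totalOrder ℚ.≤-decTotalOrder)

min-attained : {A : Set} (f : A → ℚ) (t : ℚ) (xs : List A) →
               Extremaℚ.min t (List.map f xs) ≡ t ⊎ ∃[ x ] x ∈ xs × Extremaℚ.min t (List.map f xs) ≡ f x
min-attained f t xs with Extremaℚ.argmin-sel (λ x → x) t (List.map f xs)
... | inj₁ eq   = inj₁ eq
... | inj₂ min∈ = inj₂ (∈-map⁻ f min∈)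

max-attained : {A : Set} (f : A → ℚ) (xs : List A) →
               Extremaℚ.max 0ℚ (List.map f xs) ≡ 0ℚ ⊎ ∃[ x ] Extremaℚ.max 0ℚ (List.map f xs) ≡ f x
max-attained f xs with Extremaℚ.argmax-sel (λ x → x) 0ℚ (List.map f xs)
... | inj₁ eq   = inj₁ eq
... | inj₂ max∈ with x , _ , eq ← ∈-map⁻ f max∈ = inj₂ (x , eq)

β-attained : ∀ {p} (H : GapSequence p) n .{{_ : NonZero n}} → 2 ≤ n → ∀ s →
             ∃[ k ] 0 < k × k < n × β H n s ≡ δ H n s k
β-attained H n 2≤n s = attained (min-attained (δ H n s ∘ suc) (δ H n s 1) (List.upTo (n ∸ 1)))
  where
  attained : β H n s ≡ δ H n s 1 ⊎ ∃[ k ] k ∈ List.upTo (n ∸ 1) × β H n s ≡ δ H n s (suc k) →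
             ∃[ k ] 0 < k × k < n × β H n s ≡ δ H n s k
  attained (inj₁ eq)            = 1 , s≤s z≤n , 2≤n , eq
  attained (inj₂ (k , k∈ , eq)) = suc k , s≤s z≤n ,
    subst (suc (suc k) ≤_) (ℕ.m+[n∸m]≡n (ℕ.<⇒≤ 2≤n)) (s≤s (∈-upTo⁻ k∈)) , eq

module _ {p} (H : GapSequence p) (n : ℕ) .{{_ : NonZero n}} (s : Fin p)
  (g d κ : ℕ) .{{_ : NonZero g}} (n≡g*d : n ≡ g * d) where

  open GapSequence H

  private
    norm : Fin p → ℚ
    norm j = ‖ ℤ.+ (g * κ * gap j) ℚ./ n ‖

    earlier-gaps : List (Fin p)
    earlier-gaps = List.filter (Fin._<? s) (List.allFin p)

    distance : Fin p → ℕ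
    distance j = proj₁ (norm-fraction g d κ (gap j) n n≡g*d)

    norm≡ : ∀ j → norm j ≡ ℤ.+ (g * distance j) ℚ./ n
    norm≡ j = proj₁ (proj₂ (norm-fraction g d κ (gap j) n n≡g*d))

    0/n : ℤ.+ (g * 0) ℚ./ n ≡ 0ℚ
    0/n = trans (cong (λ x → ℤ.+ x ℚ./ n) (ℕ.*-zeroʳ g)) (ℚ.0/n≡0 n)

  δ-fraction : ∃[ r ] δ H n s (g * κ) ≡ ℤ.+ (g * r) ℚ./ n
  δ-fraction = fraction (max-attained norm earlier-gaps)
    where
    fraction : δ H n s (g * κ) ≡ 0ℚ ⊎ ∃[ j ] δ H n s (g * κ) ≡ norm j →
               ∃[ r ] δ H n s (g * κ) ≡ ℤ.+ (g * r) ℚ./ n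
    -- The starting value 0 of the maximum is the fraction with r = 0.
    fraction (inj₁ eq)       = 0 , trans eq (sym 0/n)
    fraction (inj₂ (j , eq)) = distance j , trans eq (norm≡ j)

  near-multiples : ∀ {r} → δ H n s (g * κ) ≡ ℤ.+ (g * r) ℚ./ n → ∀ j → toℕ j < toℕ s →
                   ∃[ r′ ] r′ ≤ r × NearMultiple d (κ * gap j) r′
  near-multiples {r} δ≡ j j<s = distance j ,
    ℕ.*-cancelˡ-≤ g (fraction-cancel-≤ n (subst₂ ℚ._≤_ (norm≡ j) δ≡
      (All.lookup (Extremaℚ.xs≤max 0ℚ (List.map norm earlier-gaps))
        (∈-map⁺ norm (∈-filter⁺ (Fin._<? s) (∈-allFin j) j<s))))) ,
    proj₂ (proj₂ (norm-fraction g d κ (gap j) n n≡g*d))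

β-bound : ∀ {p} (H : GapSequence p) n .{{_ : NonZero n}} → 2 ≤ n → ∀ s →
          ∃[ b ] β H n s ≡ ℤ.+ b ℚ./ n × 4 * (n * n) ≤ 81 * ((2 * b + GapSequence.gap H s) * W n H)
β-bound H n 2≤n s = at-minimum (β-attained H n 2≤n s)
  where
  open GapSequence H

  Bound : Set
  Bound = ∃[ b ] β H n s ≡ ℤ.+ b ℚ./ n × 4 * (n * n) ≤ 81 * ((2 * b + gap s) * W n H)

  at-fraction : ∀ g d κ .{{_ : NonZero g}} → 2 ≤ d → n ≡ g * d → Coprime d κ →
                β H n s ≡ δ H n s (g * κ) → ∃[ r ] δ H n s (g * κ) ≡ ℤ.+ (g * r) ℚ./ n → Bound
  at-fraction g d κ 2≤d n≡ coprime β≡ (r , δ≡) =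
    g * r , trans β≡ δ≡ , n²≤cost H s d g κ r 2≤d n≡ coprime (near-multiples H n s g d κ n≡ δ≡)

  at-minimum : ∃[ k ] 0 < k × k < n × β H n s ≡ δ H n s k → Bound
  at-minimum (k , 0<k , k<n , β≡) = reduced (gcd-split n k 0<k k<n)
    where
    reduced : ∃[ g ] ∃[ d ] ∃[ κ ] NonZero g × 2 ≤ d × n ≡ g * d × k ≡ g * κ × Coprime d κ → Bound
    reduced (g , d , κ , g≢0 , 2≤d , n≡ , k≡ , coprime) =
      at-fraction g d κ {{g≢0}} 2≤d n≡ coprime (trans β≡ (cong (δ H n s) k≡)) (δ-fraction H n s g d κ {{g≢0}} n≡)

-- From rational to real bounds

ι : ℕ → ℚ
ι m = ℤ.+ m ℚ./ 1

toℚᵘ-ι : ∀ m → ℚ.toℚᵘ (ι m) ℚᵘ.≃ ℚᵘ.mkℚᵘ (ℤ.+ m) 0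
toℚᵘ-ι m = ℚ.toℚᵘ-fromℚᵘ (ℚᵘ.mkℚᵘ (ℤ.+ m) 0)

ι-+ : ∀ m n → ι (m + n) ≡ ι m ℚ.+ ι n
ι-+ m n = ℚ.toℚᵘ-injective (begin
  ℚ.toℚᵘ (ι (m + n))                                        ≈⟨ toℚᵘ-ι (m + n) ⟩
  ℚᵘ.mkℚᵘ (ℤ.+ (m + n)) 0                                   ≈⟨ ℚᵘ.*≡* (cong (ℤ._* ℤ.1ℤ) (cong₂ ℤ._+_
                                                                 (sym (ℤ.*-identityʳ (ℤ.+ m))) (sym (ℤ.*-identityʳ (ℤ.+ n))))) ⟩
  ℚᵘ.mkℚᵘ (ℤ.+ m) 0 ℚᵘ.+ ℚᵘ.mkℚᵘ (ℤ.+ n) 0                  ≈⟨ ℚᵘ.+-cong (toℚᵘ-ι m) (toℚᵘ-ι n) ⟨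
  ℚ.toℚᵘ (ι m) ℚᵘ.+ ℚ.toℚᵘ (ι n)                            ≈⟨ ℚ.toℚᵘ-homo-+ (ι m) (ι n) ⟨
  ℚ.toℚᵘ (ι m ℚ.+ ι n)                                      ∎)
  where open ℚᵘ.≃-Reasoning

ι-* : ∀ m n → ι (m * n) ≡ ι m ℚ.* ι n
ι-* m n = ℚ.toℚᵘ-injective (begin
  ℚ.toℚᵘ (ι (m * n))                                        ≈⟨ toℚᵘ-ι (m * n) ⟩
  ℚᵘ.mkℚᵘ (ℤ.+ (m * n)) 0                                   ≈⟨ ℚᵘ.*≡* (cong (ℤ._* ℤ.1ℤ) (ℤ.pos-* m n)) ⟩
  ℚᵘ.mkℚᵘ (ℤ.+ m) 0 ℚᵘ.* ℚᵘ.mkℚᵘ (ℤ.+ n) 0                  ≈⟨ ℚᵘ.*-cong (toℚᵘ-ι m) (toℚᵘ-ι n) ⟨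
  ℚ.toℚᵘ (ι m) ℚᵘ.* ℚ.toℚᵘ (ι n)                            ≈⟨ ℚ.toℚᵘ-homo-* (ι m) (ι n) ⟨
  ℚ.toℚᵘ (ι m ℚ.* ι n)                                      ∎)
  where open ℚᵘ.≃-Reasoning

ι-mono-≤ : ∀ {m n} → m ≤ n → ι m ℚ.≤ ι n
ι-mono-≤ {m} {n} m≤n = /-≤ (ℤ.+ m) (ℤ.+ n) 0 0 (ℤ.*-monoʳ-≤-nonNeg ℤ.1ℤ (ℤ.+≤+ m≤n))

0≤ι : ∀ m → 0ℚ ℚ.≤ ι m
0≤ι m = ι-mono-≤ (z≤n {m})

ι-*-/ : ∀ n .{{_ : NonZero n}} b → ι n ℚ.* (ℤ.+ b ℚ./ n) ≡ ι b
ι-*-/ n@(suc n-1) b = ℚ.toℚᵘ-injective (begin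
  ℚ.toℚᵘ (ι n ℚ.* (ℤ.+ b ℚ./ n))                  ≈⟨ ℚ.toℚᵘ-homo-* (ι n) (ℤ.+ b ℚ./ n) ⟩
  ℚ.toℚᵘ (ι n) ℚᵘ.* ℚ.toℚᵘ (ℤ.+ b ℚ./ n)          ≈⟨ ℚᵘ.*-cong (toℚᵘ-ι n) (ℚ.toℚᵘ-fromℚᵘ (ℚᵘ.mkℚᵘ (ℤ.+ b) n-1)) ⟩
  ℚᵘ.mkℚᵘ (ℤ.+ n) 0 ℚᵘ.* ℚᵘ.mkℚᵘ (ℤ.+ b) n-1      ≈⟨ ℚᵘ.*≡* (trans (ℤ.*-identityʳ (ℤ.+ n ℤ.* ℤ.+ b))
                                                       (trans (ℤ.*-comm (ℤ.+ n) (ℤ.+ b))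
                                                         (cong (ℤ.+ b ℤ.*_) (cong ℤ.+_ (sym (ℕ.*-identityˡ n)))))) ⟩
  ℚᵘ.mkℚᵘ (ℤ.+ b) 0                               ≈⟨ toℚᵘ-ι b ⟨
  ℚ.toℚᵘ (ι b)                                    ∎)
  where open ℚᵘ.≃-Reasoning

-- The first term is 1, and the alternating tail subtracted from it is at most 1/3.
⅔≤π/4 : ∀ N → 1 ≤ N → ℤ.+ 2 ℚ./ 3 ℚ.≤ ℝ.seq π/4 N
⅔≤π/4 (suc N) _ = ℚ.+-monoʳ-≤ ℚ.1ℚ (ℚ.neg-antimono-≤ (proj₂ (alternating-bounds 1 N)))

-- Truncating at c only enlarges the denominator and w ≥ 0, so the estimate also holds at stages
-- where q is below c.
*-recip⊔-≤ : ∀ {c} (0<c : 0ℚ ℚ.< c) {x w q} → 0ℚ ℚ.≤ w → x ℚ.≤ w ℚ.* q → x ℚ.* recip⊔ 0<c q ℚ.≤ w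
*-recip⊔-≤ {c} 0<c {x} {w} {q} 0≤w x≤wq = begin
  x ℚ.* recip⊔ 0<c q              ≤⟨ ℚ.*-monoʳ-≤-nonNeg (recip⊔ 0<c q) {{ℚ.pos⇒nonNeg (recip⊔ 0<c q)}} x≤wu ⟩
  w ℚ.* u ℚ.* recip⊔ 0<c q        ≡⟨ ℚ.*-assoc w u (recip⊔ 0<c q) ⟩
  w ℚ.* (u ℚ.* recip⊔ 0<c q)      ≡⟨ cong (w ℚ.*_) (ℚ.*-inverseʳ u) ⟩
  w ℚ.* ℚ.1ℚ                      ≡⟨ ℚ.*-identityʳ w ⟩
  w                               ∎
  where
  open ℚ.≤-Reasoning
  u : ℚ
  u = c ℚ.⊔ q
  instance
    u-pos : ℚ.Positive u
    u-pos = ℚ.positive (ℚ.<-≤-trans 0<c (ℚ.p≤p⊔q c q))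
    u-nonZero : ℚ.NonZero u
    u-nonZero = ℚ.pos⇒nonZero u
    recip-pos : ℚ.Positive (recip⊔ 0<c q)
    recip-pos = ℚ.1/pos⇒pos u
  x≤wu : x ℚ.≤ w ℚ.* u
  x≤wu = ℚ.≤-trans x≤wq (ℚ.*-monoˡ-≤-nonNeg w {{ℚ.nonNegative 0≤w}} (ℚ.p≤q⊔p c q))

ι-bound : ∀ n b h w → 4 * (n * n) ≤ 81 * ((2 * b + h) * w) →
          ι 4 ℚ.* ι (n ^ 2) ℚ.≤ ι 81 ℚ.* ((ι 2 ℚ.* ι b ℚ.+ ι h) ℚ.* ι w)
ι-bound n b h w bound = subst₂ ℚ._≤_ lhs≡ rhs≡ (ι-mono-≤ bound)
  where
  lhs≡ : ι (4 * (n * n)) ≡ ι 4 ℚ.* ι (n ^ 2)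
  lhs≡ = trans (ι-* 4 (n * n)) (cong (λ m → ι 4 ℚ.* ι (n * m)) (sym (ℕ.*-identityʳ n)))
  rhs≡ : ι (81 * ((2 * b + h) * w)) ≡ ι 81 ℚ.* ((ι 2 ℚ.* ι b ℚ.+ ι h) ℚ.* ι w)
  rhs≡ = trans (ι-* 81 ((2 * b + h) * w)) (cong (ι 81 ℚ.*_) (trans (ι-* (2 * b + h) w)
    (cong (ℚ._* ι w) (trans (ι-+ (2 * b) h) (cong (ℚ._+ ι h) (ι-* 2 b))))))

module _ (w h b : ℚ) (0≤w : 0ℚ ℚ.≤ w) (0≤h : 0ℚ ℚ.≤ h) (0≤b : 0ℚ ℚ.≤ b) where

  -- With π ≥ 8/3 both 8π ≥ 81/4 and π ≥ 2.
  scale-by-π : ∀ {x q} → ℤ.+ 2 ℚ./ 3 ℚ.≤ q → ι 4 ℚ.* x ℚ.≤ ι 81 ℚ.* ((ι 2 ℚ.* b ℚ.+ h) ℚ.* w) →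
               x ℚ.≤ w ℚ.* (ι 8 ℚ.* (ι 4 ℚ.* q) ℚ.* (h ℚ.+ ι 4 ℚ.* q ℚ.* b))
  scale-by-π {x} {q} ⅔≤q 4x≤ = begin
    x
      -- `¼ ℚ.* ι 4` evaluates to 1, so the identity law applies as it stands.
      ≡⟨ ℚ.*-identityˡ x ⟨
    ¼ ℚ.* ι 4 ℚ.* x
      ≡⟨ ℚ.*-assoc ¼ (ι 4) x ⟩
    ¼ ℚ.* (ι 4 ℚ.* x)
      ≤⟨ ℚ.*-monoˡ-≤-nonNeg ¼ 4x≤ ⟩
    ¼ ℚ.* (ι 81 ℚ.* ((ι 2 ℚ.* b ℚ.+ h) ℚ.* w))
      ≡⟨ solveℚ 3 (λ w h b → conℚ ¼ ·ℚ (conℚ (ι 81) ·ℚ ((conℚ (ι 2) ·ℚ b +ℚ h) ·ℚ w)) ≔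
                             w ·ℚ (conℚ (¼ ℚ.* ι 81) ·ℚ (h +ℚ conℚ (ι 2) ·ℚ b))) refl w h b ⟩
    w ℚ.* (¼ ℚ.* ι 81 ℚ.* (h ℚ.+ ι 2 ℚ.* b))
      ≤⟨ ℚ.*-monoˡ-≤-nonNeg w {{ℚ.nonNegative 0≤w}}
           (*-mono 0≤h+2b (ℚ.≤-trans (from-yes (0ℚ ℚ.≤? ¼ ℚ.* ι 81)) 81/4≤8π) 81/4≤8π
             (ℚ.+-monoʳ-≤ h (ℚ.*-monoʳ-≤-nonNeg b {{ℚ.nonNegative 0≤b}} 2≤π))) ⟩
    w ℚ.* (ι 8 ℚ.* (ι 4 ℚ.* q) ℚ.* (h ℚ.+ ι 4 ℚ.* q ℚ.* b)) ∎
    where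
    open ℚ.≤-Reasoning
    ¼ : ℚ
    ¼ = ℤ.1ℤ ℚ./ 4
    4⅔≤π : ι 4 ℚ.* (ℤ.+ 2 ℚ./ 3) ℚ.≤ ι 4 ℚ.* q
    4⅔≤π = ℚ.*-monoˡ-≤-nonNeg (ι 4) ⅔≤q
    2≤π : ι 2 ℚ.≤ ι 4 ℚ.* q
    2≤π = ℚ.≤-trans (from-yes (ι 2 ℚ.≤? ι 4 ℚ.* (ℤ.+ 2 ℚ./ 3))) 4⅔≤π
    81/4≤8π : ¼ ℚ.* ι 81 ℚ.≤ ι 8 ℚ.* (ι 4 ℚ.* q)
    81/4≤8π = ℚ.≤-trans (from-yes (¼ ℚ.* ι 81 ℚ.≤? ι 8 ℚ.* (ι 4 ℚ.* (ℤ.+ 2 ℚ./ 3))))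
      (ℚ.*-monoˡ-≤-nonNeg (ι 8) 4⅔≤π)
    0≤h+2b : 0ℚ ℚ.≤ h ℚ.+ ι 2 ℚ.* b
    0≤h+2b = ℚ.+-mono-≤ 0≤h (*-nonNeg (from-yes (0ℚ ℚ.≤? ι 2)) 0≤b)

-- The maximum over s and the inequality between reals

maxLowerBound-preserves : ∀ {p} (H : GapSequence p) n .{{_ : NonZero n}} (P : ℝ → Set) →
  P (fromℕ 0) → (∀ {x y} → P x → P y → P (x ⊔ᴿ y)) → (∀ s → P (lowerBound H n s)) →
  P (maxLowerBound H n)
maxLowerBound-preserves {p} H n P P0 P⊔ Pbound =
  foldr-preserves (List.filter (λ s → 1 ≤? toℕ s) (List.allFin p))
  where
  foldr-preserves : ∀ ss → P (List.foldr _⊔ᴿ_ (fromℕ 0) (List.map (lowerBound H n) ss))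
  foldr-preserves []       = P0
  foldr-preserves (s ∷ ss) = P⊔ (Pbound s) (foldr-preserves ss)

⊔ᴿ-lub : ∀ {x y z} → x ≤ᴿ z → y ≤ᴿ z → x ⊔ᴿ y ≤ᴿ z
⊔ᴿ-lub x≤z y≤z ε 0<ε with M , x≤ ← x≤z ε 0<ε | N , y≤ ← y≤z ε 0<ε =
  M ⊔ N , λ n ≤n → ℚ.⊔-lub (x≤ n (⊔ˡ ≤n)) (y≤ n (⊔ʳ ≤n))

module _ {p} (H : GapSequence p) (n : ℕ) .{{_ : NonZero n}} (2≤n : 2 ≤ n) where

  open GapSequence H

  lowerBound≤W : ∀ s N → 1 ≤ N → ℝ.seq (lowerBound H n s) N ℚ.≤ ι (W n H)
  lowerBound≤W s N 1≤N = from-fraction (β-bound H n 2≤n s)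
    where
    q : ℚ
    q = ℝ.seq π/4 N
    from-fraction : ∃[ b ] β H n s ≡ ℤ.+ b ℚ./ n × 4 * (n * n) ≤ 81 * ((2 * b + gap s) * W n H) →
                    ℝ.seq (lowerBound H n s) N ℚ.≤ ι (W n H)
    from-fraction (b , β≡ , bound) = *-recip⊔-≤ (proj₁ (proj₂ (denominator-pos H n s))) (0≤ι (W n H))
      (subst (λ y → ι (n ^ 2) ℚ.≤ ι (W n H) ℚ.* (ι 8 ℚ.* (ι 4 ℚ.* q) ℚ.* (ι (gap s) ℚ.+ y))) πb≡
        (scale-by-π (ι (W n H)) (ι (gap s)) (ι b) (0≤ι (W n H)) (0≤ι (gap s)) (0≤ι b)
          (⅔≤π/4 N 1≤N)
          (ι-bound n b (gap s) (W n H) bound)))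
      where
      πb≡ : ι 4 ℚ.* q ℚ.* ι b ≡ ι 4 ℚ.* q ℚ.* ι n ℚ.* β H n s
      πb≡ = trans (cong (ι 4 ℚ.* q ℚ.*_) (trans (sym (ι-*-/ n b)) (cong (ι n ℚ.*_) (sym β≡))))
        (sym (ℚ.*-assoc (ι 4 ℚ.* q) (ι n) (β H n s)))

≤⇒≤ᴿ : ∀ x m → (∀ N → 1 ≤ N → ℝ.seq x N ℚ.≤ ι m) → x ≤ᴿ fromℕ m
≤⇒≤ᴿ x m bound ε 0<ε = 1 , λ N 1≤N → ℚ.≤-trans (bound N 1≤N) (p≤p+ε (ℚ.<⇒≤ 0<ε))

lowerBound≤ᴿW : ∀ {p} (H : GapSequence p) n .{{_ : NonZero n}} → 2 ≤ n → ∀ s → lowerBound H n s ≤ᴿ fromℕ (W n H)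
lowerBound≤ᴿW H n 2≤n s = ≤⇒≤ᴿ (lowerBound H n s) (W n H) (lowerBound≤W H n 2≤n s)

theoremB3 : (n : ℕ) .{{_ : NonZero n}} → 2 ≤ n → (p : ℕ) (H : GapSequence p) →
    ((s : Fin p) → 1 ≤ toℕ s → lowerBound H n s ≤ᴿ fromℕ (W n H)) ×
    (maxLowerBound H n ≤ᴿ fromℕ (W n H))
theoremB3 n {{n≢0}} 2≤n p H =
  (λ s _ → lowerBound≤ᴿW H n {{n≢0}} 2≤n s) ,
  maxLowerBound-preserves H n {{n≢0}} (_≤ᴿ fromℕ (W n H))
    (≤⇒≤ᴿ (fromℕ 0) (W n H) (λ _ _ → 0≤ι (W n H)))
    (λ {x} {y} → ⊔ᴿ-lub {x} {y} {fromℕ (W n H)})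
    (lowerBound≤ᴿW H n {{n≢0}} 2≤n)
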